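{- For every $\epsilon>0$ there is an $N>0$ such that for every even $n>N$, $$\bigl|\{F\in\mathcal{G}'_{16}(n):\ \alpha(\pi(F))>0.454\,n\}\bigr|<\epsilon\,(3n-1)!!.$$
   Context: Configuration model: for an even positive integer $n$, let $V_n=[n]=\{1,\dots,n\}$ (the vertices) and $W_n=V_n\times[3]$ (the points). A pairing (configuration) is a perfect matching on $W_n$; $\mathcal{F}_3(n)$ is the set of all $(3n-1)!!$ pairings. For $F\in\mathcal{F}_3(n)$, $\pi(F)$ is the 3-regular multigraph on $V_n$ obtained by replacing each point $(v,k)$ by its first coordinate $v$ (so each matching edge becomes an edge of $\pi(F)$, possibly a loop or a multiple edge). $\mathcal{G}_g(n)$ is the set of simple cubic (3-regular) graphs on $[n]$ with girth at least $g$, and $\mathcal{G}'_g(n)=\{F\in\mathcal{F}_3(n):\pi(F)\in\mathcal{G}_g(n)\}$. $\alpha(\cdot)$ denotes the independence number. -}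

module Defs where

open import Data.Fin using (Fin)
import Data.Fin.Properties as Fin
open import Data.List using (List; []; _∷_; _++_; map; filter; length; concatMap; cartesianProduct; allFin)
import Data.List.Membership.DecPropositional as DecMembership
open import Data.List.Membership.Propositional using (_∈_)
open import Data.List.Extrema.Nat using (max)
open import Data.List.Relation.Unary.All as All using (All)
open import Data.List.Relation.Unary.AllPairs as AllPairs using (AllPairs)
open import Data.Nat using (ℕ; zero; suc; _*_; _≤_; _<_; _≤?_)
import Data.Nat.Properties as ℕ
open import Data.Product using (_×_; _,_; proj₁)
import Data.Product as Product
open import Data.Product.Properties using (≡-dec)
open import Data.Sum using (_⊎_)
open import Data.Vec using (Vec; []; _∷_; _∷ʳ_)
open import Data.Vec.Relation.Unary.Linked as Linked using (Linked)
import Data.Vec.Relation.Unary.AllPairs as VecAllPairs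
open import Data.Vec.Relation.Unary.Unique.Propositional using (Unique)
open import Data.Empty using (⊥)
open import Relation.Binary using (DecidableEquality)
open import Relation.Binary.PropositionalEquality using (_≡_; _≢_)
open import Relation.Nullary using (¬_; Dec; no)
open import Relation.Nullary.Decidable using (map′; ¬?; _×-dec_; _⊎-dec_)
open import Relation.Unary using (Decidable)

_!! : ℕ → ℕ
zero        !! = 1
suc zero    !! = 1
suc (suc n) !! = suc (suc n) * n !!

-- For a list without repetitions, `sublists` lists every subset exactly
-- once, and `twoSubsets` every two-element subset exactly once (with one
-- chosen orientation).

sublists : {A : Set} → List A → List (List A)
sublists []       = [] ∷ []
sublists (x ∷ xs) = map (x ∷_) (sublists xs) ++ sublists xs

twoSubsets : {A : Set} → List A → List (A × A)
twoSubsets []       = []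
twoSubsets (x ∷ xs) = map (x ,_) xs ++ twoSubsets xs

-- A multigraph on V is its list of edges, each given by its two ends; the
-- order of the ends is irrelevant to every notion below.
Multigraph : Set → Set
Multigraph V = List (V × V)

module _ {V : Set} (_≟_ : DecidableEquality V) where

  -- A loop contributes 2 to the degree of its vertex.
  degree : Multigraph V → V → ℕ
  degree G v = length (filter (v ≟_) (concatMap (λ (x , y) → x ∷ y ∷ []) G))

  Regular : ℕ → Multigraph V → Set
  Regular d G = ∀ v → degree G v ≡ d

module _ {V : Set} where

  Parallel : V × V → V × V → Set
  Parallel (u , v) (x , y) = (u ≡ x × v ≡ y) ⊎ (u ≡ y × v ≡ x)

  Simple : Multigraph V → Set
  Simple G = All (λ (u , v) → u ≢ v) G × AllPairs (λ e f → ¬ Parallel e f) G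

  Adjacent : Multigraph V → V → V → Set
  Adjacent G u v = (u , v) ∈ G ⊎ (v , u) ∈ G

  -- c = (v₁, …, vₖ) is a cycle v₁ v₂ … vₖ v₁ of length k.  The bound 3 ≤ k
  -- is appropriate because girth is only considered for simple graphs.
  IsCycle : Multigraph V → {k : ℕ} → Vec V k → Set
  IsCycle G []               = ⊥
  IsCycle G {k} c@(v ∷ _) = 3 ≤ k × Unique c × Linked (Adjacent G) (c ∷ʳ v)

  -- Acyclic graphs have infinite girth.
  GirthAtLeast : ℕ → Multigraph V → Set
  GirthAtLeast g G = ∀ {k} (c : Vec V k) → IsCycle G c → g ≤ k

  Independent : Multigraph V → List V → Set
  Independent G S = All (λ (u , v) → ¬ (u ∈ S × v ∈ S)) G

𝓖 : ℕ → (n : ℕ) → Multigraph (Fin n) → Set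
𝓖 g n G = Simple G × Regular Fin._≟_ 3 G × GirthAtLeast g G

V : (n : ℕ) → List (Fin n)
V n = allFin n

Point : ℕ → Set
Point n = Fin n × Fin 3

W : (n : ℕ) → List (Point n)
W n = cartesianProduct (V n) (allFin 3)

_≟ᵖ_ : ∀ {n} → DecidableEquality (Point n)
_≟ᵖ_ = ≡-dec Fin._≟_ Fin._≟_

PerfectMatching : ∀ {n} → Multigraph (Point n) → Set
PerfectMatching = Regular _≟ᵖ_ 1

perfectMatching? : ∀ {n} → Decidable (PerfectMatching {n})
perfectMatching? F = map′ (λ h (v , k) → h v k) (λ h v k → h (v , k))
  (Fin.all? λ v → Fin.all? λ k → degree _≟ᵖ_ F (v , k) ℕ.≟ 1)

𝓕₃ : (n : ℕ) → List (Multigraph (Point n))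
𝓕₃ n = filter perfectMatching? (sublists (twoSubsets (W n)))

π : ∀ {n} → Multigraph (Point n) → Multigraph (Fin n)
π = map (Product.map proj₁ proj₁)

module _ {n : ℕ} where

  open DecMembership (Fin._≟_ {n}) using (_∈?_)
  open DecMembership (≡-dec (Fin._≟_ {n}) (Fin._≟_ {n})) using () renaming (_∈?_ to _∈ᵉ?_)

  independent? : (G : Multigraph (Fin n)) → Decidable (Independent G)
  independent? G S = All.all? (λ (u , v) → ¬? (u ∈? S ×-dec v ∈? S)) G

  α : Multigraph (Fin n) → ℕ
  α G = max 0 (map length (filter (independent? G) (sublists (V n))))

  simple? : Decidable (Simple {Fin n})
  simple? G =
    All.all? (λ (u , v) → ¬? (u Fin.≟ v)) G
    ×-dec AllPairs.allPairs?
      (λ (u , v) (x , y) → ¬? ((u Fin.≟ x ×-dec v Fin.≟ y) ⊎-dec (u Fin.≟ y ×-dec v Fin.≟ x))) G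

  isCycle? : (G : Multigraph (Fin n)) {k : ℕ} → Decidable (IsCycle G {k})
  isCycle? G []              = no λ ()
  isCycle? G {k} c@(v ∷ _) =
    3 ≤? k
    ×-dec VecAllPairs.allPairs? (λ x y → ¬? (x Fin.≟ y)) c
    ×-dec Linked.linked? (λ x y → (x , y) ∈ᵉ? G ⊎-dec (y , x) ∈ᵉ? G) (c ∷ʳ v)

  allVec? : ∀ k {P : Vec (Fin n) k → Set} → Decidable P → Dec (∀ c → P c)
  allVec? zero    P? = map′ (λ { p [] → p }) (λ p → p []) (P? [])
  allVec? (suc k) P? = map′ (λ { p (x ∷ c) → p x c }) (λ p x c → p (x ∷ c))
    (Fin.all? λ x → allVec? k λ c → P? (x ∷ c))

  girthAtLeast? : ∀ g → Decidable (GirthAtLeast {Fin n} g)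
  girthAtLeast? g G = map′ to from
    (ℕ.allUpTo? (λ k → allVec? k λ c → ¬? (isCycle? G c)) g)
    where
    NoShortCycle : Set
    NoShortCycle = ∀ {k} → k < g → (c : Vec (Fin n) k) → ¬ IsCycle G c
    to : NoShortCycle → GirthAtLeast g G
    to h c cyc = ℕ.≮⇒≥ λ k<g → h k<g c cyc
    from : GirthAtLeast g G → NoShortCycle
    from h k<g c cyc = ℕ.<⇒≱ k<g (h c cyc)

𝓖? : ∀ g n → Decidable (𝓖 g n)
𝓖? g n G =
  simple? G ×-dec (Fin.all? λ v → degree Fin._≟_ G v ℕ.≟ 3) ×-dec girthAtLeast? g G

𝓖′ : ℕ → (n : ℕ) → List (Multigraph (Point n))
𝓖′ g n = filter (λ F → 𝓖? g n (π F)) (𝓕₃ n)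

{-# OPTIONS --safe #-}
module Submission where

-- The interpolation method.  Weight a partial configuration G by 16 ^ α(π G)
-- and let c be the fraction of its free points lying over vertices that belong
-- to every maximum independent set.  Joining two random free points by an edge
-- multiplies the weight by 1 − (15/16) c² on average; deleting the vertex of a
-- random free point with probability 2/3 (a "kill", realised by a loop)
-- multiplies it by 1 − (15/16) (2/3) c.  Because (c − 2/3)² ≥ 0, the operators
-- satisfy match + 7/12 ≤ 2 kill on the weight.  They commute, so this
-- inequality can be iterated along Dyck paths, whose number is a Catalan number:
-- K matches are dominated by 2 K kills up to (12/7) ^ K and a factor polynomial
-- in K.  When there are only kills the vertices decouple, and the mean weight
-- is at most ((15 + 27) / 27) ^ n.  With K close to 3 n / 2 the mean of
-- 16 ^ α is therefore at most ((14/9) (12/7) ^ (3/2)) ^ n, up to a polynomial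
-- factor, and (14/9) (12/7) ^ (3/2) < 16 ^ 0.454; apply Markov's inequality.

open import Defs
open import Data.Empty using (⊥-elim)
open import Data.Bool using (if_then_else_)
open import Data.Fin using (Fin)
import Data.Fin.Properties as Fin
open import Data.List using (List; []; _∷_; _++_; map; filter; length; allFin; cartesianProduct)
open import Data.List.Extrema.Nat using (xs≤max; argmax-sel)
import Data.List.Membership.DecPropositional as DecMembership
open import Data.List.Membership.Propositional using (_∈_; _∉_)
open import Data.List.Membership.Propositional.Properties using (∈-allFin; ∈-cartesianProduct⁺; ∈-map⁺; ∈-map⁻; ∈-++⁺ˡ; ∈-++⁺ʳ; ∈-++⁻; ∈-filter⁺; ∈-filter⁻)
open import Data.List.Properties using (length-tabulate)
open import Data.List.Relation.Binary.Sublist.Propositional using ([]; _∷_; _∷ʳ_; ⊆-trans; minimum; lookup) renaming (_⊆_ to _⊑_)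
open import Data.List.Relation.Binary.Sublist.Propositional.Properties using (filter-⊆; All-resp-⊆)
open import Data.List.Relation.Binary.Subset.Propositional using (_⊆_)
import Data.List.Relation.Binary.Subset.Propositional.Properties as Subset
open import Data.List.Relation.Unary.All as All using (All; []; _∷_)
import Data.List.Relation.Unary.All.Properties as AllP
open import Data.List.Relation.Unary.AllPairs using ([]; _∷_)
open import Data.List.Relation.Unary.Any using (here; there)
open import Data.List.Relation.Unary.Unique.Propositional using (Unique)
import Data.List.Relation.Unary.Unique.Propositional.Properties as Unique
open import Data.Nat hiding (_/_; _<?_)
import Data.Nat as ℕ using (_<?_)
import Data.Nat.DivMod as ℕ
open import Data.Nat.Divisibility using (_∣_; divides)
open import Data.Nat.ListAction using (sum)
open import Data.Nat.Properties hiding (_<?_)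
open import Data.Nat.Tactic.RingSolver using (solve-∀)
open import Data.Product using (_×_; _,_; proj₁; proj₂; ∃-syntax; swap)
open import Data.Product.Properties using (≡-dec; ,-injectiveˡ; ,-injectiveʳ)
open import Data.Sum using (_⊎_; inj₁; inj₂)
open import Function using (_∘_; id; case_of_; it)
open import Relation.Binary using (DecidableEquality)
open import Relation.Binary.PropositionalEquality using (_≡_; _≢_; refl; sym; trans; cong; cong₂; subst; subst₂; module ≡-Reasoning)
open import Relation.Nullary using (¬_; Dec; yes; no; does)
open import Relation.Nullary.Decidable using (¬?; _×-dec_; _⊎-dec_; _→-dec_)
open import Relation.Unary using (Decidable)

-- The obstacle is that a match couples two vertices, so its mean loss is quadratic in c, while only
-- a loss linear in c can be followed vertex by vertex. Replacing c² by its tangent at 2/3 makes it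
-- linear and leaves the constant 7/12 = 1 - (15/16) (2/3)². A loop deletes its vertex because it
-- bars that vertex from every independent set. Points are drawn without replacement, so the
-- quadratic loss is exact only up to a correction that shrinks with the number of free points.
-- Therefore 7/12 is lowered to 699/1200 and the inequality is applied only while 300 points are
-- free. This is why the paths are Dyck paths: a match uses one point more than the kill it
-- replaces, a dropped kill gives one back, and the total must stay within budget. The blocks of 16
-- vertices leave out 100 to 114 vertices, whose points are the reserve. The margin is thin: a block
-- costs about 2 ^ 28.86 against a threshold of 2 ^ 29, and both 699/1200 and the factor that
-- absorbs the polynomials have to fit into it.

⟦_⟧ : {P : Set} → Dec P → ℕ
⟦ P? ⟧ = if does P? then 1 else 0

⟦⟧-true : {P : Set} (P? : Dec P) → P → ⟦ P? ⟧ ≡ 1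
⟦⟧-true (yes _) _ = refl
⟦⟧-true (no ¬p) p = ⊥-elim (¬p p)

⟦⟧-false : {P : Set} (P? : Dec P) → ¬ P → ⟦ P? ⟧ ≡ 0
⟦⟧-false (yes p) ¬p = ⊥-elim (¬p p)
⟦⟧-false (no _)  _  = refl

⟦⟧-mono : {P Q : Set} (P? : Dec P) (Q? : Dec Q) → (P → Q) → ⟦ P? ⟧ ≤ ⟦ Q? ⟧
⟦⟧-mono (no _)  Q? _ = z≤n
⟦⟧-mono (yes p) Q? f = ≤-reflexive (sym (⟦⟧-true Q? (f p)))

⟦⟧-cong : {P Q : Set} (P? : Dec P) (Q? : Dec Q) → (P → Q) → (Q → P) → ⟦ P? ⟧ ≡ ⟦ Q? ⟧
⟦⟧-cong P? Q? f g = ≤-antisym (⟦⟧-mono P? Q? f) (⟦⟧-mono Q? P? g)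

⟦⟧-idem : {P : Set} (P? : Dec P) → ⟦ P? ⟧ * ⟦ P? ⟧ ≡ ⟦ P? ⟧
⟦⟧-idem (yes _) = refl
⟦⟧-idem (no _)  = refl

-- Finite sums over lists

module _ {A : Set} where

  ∑ : List A → (A → ℕ) → ℕ
  ∑ xs f = sum (map f xs)

  ∑-cong-∈ : ∀ xs {f g : A → ℕ} → (∀ x → x ∈ xs → f x ≡ g x) → ∑ xs f ≡ ∑ xs g
  ∑-cong-∈ []       h = refl
  ∑-cong-∈ (x ∷ xs) h = cong₂ _+_ (h x (here refl)) (∑-cong-∈ xs λ y → h y ∘ there)

  ∑-cong : ∀ xs {f g : A → ℕ} → (∀ x → f x ≡ g x) → ∑ xs f ≡ ∑ xs g
  ∑-cong xs h = ∑-cong-∈ xs λ x _ → h x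

  ∑-mono : ∀ xs {f g : A → ℕ} → (∀ x → x ∈ xs → f x ≤ g x) → ∑ xs f ≤ ∑ xs g
  ∑-mono []       h = z≤n
  ∑-mono (x ∷ xs) h = +-mono-≤ (h x (here refl)) (∑-mono xs λ y → h y ∘ there)

  ∑-+ : ∀ xs (f g : A → ℕ) → ∑ xs (λ x → f x + g x) ≡ ∑ xs f + ∑ xs g
  ∑-+ []       f g = refl
  ∑-+ (x ∷ xs) f g rewrite ∑-+ xs f g = lemma (f x) (g x) (∑ xs f) (∑ xs g)
    where
    lemma : ∀ a b c d → a + b + (c + d) ≡ a + c + (b + d)
    lemma = solve-∀

  ∑-*ˡ : ∀ xs c (f : A → ℕ) → ∑ xs (λ x → c * f x) ≡ c * ∑ xs f
  ∑-*ˡ []       c f = sym (*-zeroʳ c)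
  ∑-*ˡ (x ∷ xs) c f rewrite ∑-*ˡ xs c f = sym (*-distribˡ-+ c (f x) (∑ xs f))

  ∑-0 : ∀ xs → ∑ xs (λ _ → 0) ≡ 0
  ∑-0 []       = refl
  ∑-0 (x ∷ xs) = ∑-0 xs

  ∑-1 : ∀ xs → ∑ xs (λ _ → 1) ≡ length xs
  ∑-1 []       = refl
  ∑-1 (x ∷ xs) = cong suc (∑-1 xs)

  ∑-++ : ∀ xs ys (f : A → ℕ) → ∑ (xs ++ ys) f ≡ ∑ xs f + ∑ ys f
  ∑-++ []       ys f = refl
  ∑-++ (x ∷ xs) ys f rewrite ∑-++ xs ys f = sym (+-assoc (f x) _ _)

  ∑-pick : ∀ xs x (f : A → ℕ) → Unique xs → x ∈ xs →
    (∀ y → y ≢ x → f y ≡ 0) → ∑ xs f ≡ f x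
  ∑-pick (x ∷ xs) .x f (x∉ ∷ _) (here refl) h =
    trans (cong (f x +_) (trans (∑-cong-∈ xs λ y y∈ → h y λ y≡x → All.lookup x∉ y∈ (sym y≡x)) (∑-0 xs)))
          (+-identityʳ _)
  ∑-pick (y ∷ xs) x f (y∉ ∷ u) (there x∈) h =
    cong₂ _+_ (h y (All.lookup y∉ x∈)) (∑-pick xs x f u x∈ h)

  ∑-filter-≤ : ∀ {P : A → Set} (P? : Decidable P) xs (f : A → ℕ) → ∑ (filter P? xs) f ≤ ∑ xs f
  ∑-filter-≤ P? []       f = z≤n
  ∑-filter-≤ P? (x ∷ xs) f with P? x
  ... | yes _ = +-monoʳ-≤ (f x) (∑-filter-≤ P? xs f)
  ... | no _  = ≤-trans (∑-filter-≤ P? xs f) (m≤n+m _ _)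

  markov : ∀ {P : A → Set} (P? : Decidable P) xs (f : A → ℕ) c → (∀ x → P x → c ≤ f x) →
    length (filter P? xs) * c ≤ ∑ xs f
  markov P? []       f c h = z≤n
  markov P? (x ∷ xs) f c h with P? x
  ... | yes p = +-mono-≤ (h x p) (markov P? xs f c h)
  ... | no _  = ≤-trans (markov P? xs f c h) (m≤n+m _ _)

∑-map : {A B : Set} (g : A → B) (f : B → ℕ) → ∀ xs → ∑ (map g xs) f ≡ ∑ xs (f ∘ g)
∑-map g f []       = refl
∑-map g f (x ∷ xs) = cong (f (g x) +_) (∑-map g f xs)

∑-swap : {A B : Set} (xs : List A) (ys : List B) (f : A → B → ℕ) →
  ∑ xs (λ x → ∑ ys (f x)) ≡ ∑ ys (λ y → ∑ xs (λ x → f x y))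
∑-swap []       ys f = sym (∑-0 ys)
∑-swap (x ∷ xs) ys f rewrite ∑-swap xs ys f = sym (∑-+ ys (f x) _)

*-left-comm : ∀ a b c → a * (b * c) ≡ b * (a * c)
*-left-comm = solve-∀

⟦⟧-× : {P Q : Set} (P? : Dec P) (Q? : Dec Q) → ⟦ P? ⟧ * ⟦ Q? ⟧ ≡ ⟦ P? ×-dec Q? ⟧
⟦⟧-× (yes _) (yes _) = refl
⟦⟧-× (yes _) (no _)  = refl
⟦⟧-× (no _)  _       = refl

-- Exploration of a pairing by matches and kills

_≋_ : {A : Set} → List A → List A → Set
xs ≋ ys = xs ⊆ ys × ys ⊆ xs

≋-refl : {A : Set} {xs : List A} → xs ≋ xs
≋-refl = (λ x → x) , (λ x → x)

≋-trans : {A : Set} {xs ys zs : List A} → xs ≋ ys → ys ≋ zs → xs ≋ zs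
≋-trans (a , b) (c , d) = (λ x → c (a x)) , (λ x → b (d x))

≋-∷ : {A : Set} {xs ys : List A} (x : A) → xs ≋ ys → (x ∷ xs) ≋ (x ∷ ys)
≋-∷ x (a , b) = Subset.∷⁺ʳ x a , Subset.∷⁺ʳ x b

⊆-swap : {A : Set} {xs : List A} (x y : A) → (x ∷ y ∷ xs) ⊆ (y ∷ x ∷ xs)
⊆-swap x y (here p)          = there (here p)
⊆-swap x y (there (here p))  = here p
⊆-swap x y (there (there p)) = there (there p)

≋-swap : {A : Set} {xs : List A} (x y : A) → (x ∷ y ∷ xs) ≋ (y ∷ x ∷ xs)
≋-swap x y = ⊆-swap x y , ⊆-swap y x

iterate : {F : Set} → ℕ → (F → F) → F → F
iterate zero    O Y = Y
iterate (suc k) O Y = iterate k O (O Y)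

iterate-suc : {F : Set} (k : ℕ) (O : F → F) (Y : F) → O (iterate k O Y) ≡ iterate k O (O Y)
iterate-suc zero    O Y = refl
iterate-suc (suc k) O Y = iterate-suc k O (O Y)

module Exploration {P : Set} (_≟_ : DecidableEquality P) (W : List P)
                   (complete : ∀ h → h ∈ W) (unique : Unique W) where

  open DecMembership _≟_ using (_∈?_)

  free : List P → P → ℕ
  free u h = ⟦ ¬? (h ∈? u) ⟧

  ∑∉ : List P → (P → ℕ) → ℕ
  ∑∉ u f = ∑ W λ h → free u h * f h

  #free : List P → ℕ
  #free u = ∑∉ u λ _ → 1

  free-≋ : ∀ {u u′} → u ≋ u′ → ∀ h → free u h ≡ free u′ h
  free-≋ {u} {u′} (s , s′) h = ⟦⟧-cong (¬? (h ∈? u)) (¬? (h ∈? u′)) (λ h∉ h∈ → h∉ (s′ h∈)) (λ h∉ h∈ → h∉ (s h∈))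

  ∑∉-mono : ∀ u {f g} → (∀ h → h ∉ u → f h ≤ g h) → ∑∉ u f ≤ ∑∉ u g
  ∑∉-mono u {f} {g} le = ∑-mono W λ h _ → aux h
    where
    aux : ∀ h → free u h * f h ≤ free u h * g h
    aux h with h ∈? u
    ... | yes _ = z≤n
    ... | no h∉ = *-monoʳ-≤ 1 (le h h∉)

  ∑∉-cong : ∀ u {f g} → (∀ h → h ∉ u → f h ≡ g h) → ∑∉ u f ≡ ∑∉ u g
  ∑∉-cong u eq = ≤-antisym (∑∉-mono u λ h h∉ → ≤-reflexive (eq h h∉))
                           (∑∉-mono u λ h h∉ → ≤-reflexive (sym (eq h h∉)))

  ∑∉-≋ : ∀ {u u′} → u ≋ u′ → ∀ f → ∑∉ u f ≡ ∑∉ u′ f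
  ∑∉-≋ s f = ∑-cong W λ h → cong (_* f h) (free-≋ s h)

  ∑∉-+ : ∀ u f g → ∑∉ u (λ h → f h + g h) ≡ ∑∉ u f + ∑∉ u g
  ∑∉-+ u f g = trans (∑-cong W λ h → *-distribˡ-+ (free u h) (f h) (g h)) (∑-+ W _ _)

  ∑∉-*ˡ : ∀ u c f → ∑∉ u (λ h → c * f h) ≡ c * ∑∉ u f
  ∑∉-*ˡ u c f = trans (∑-cong W λ h → *-left-comm (free u h) c (f h)) (∑-*ˡ W c _)

  ∑∉-const : ∀ u c → ∑∉ u (λ _ → c) ≡ c * #free u
  ∑∉-const u c = trans (∑∉-cong u λ _ _ → sym (*-identityʳ c)) (∑∉-*ˡ u c _)

  ∑∉-∷ : ∀ {u h} f → h ∉ u → ∑∉ (h ∷ u) f + f h ≡ ∑∉ u f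
  ∑∉-∷ {u} {h} f h∉ = begin
    ∑∉ (h ∷ u) f + f h
      ≡⟨ cong (∑∉ (h ∷ u) f +_) (sym (trans (∑-pick W h _ unique (complete h) off) at)) ⟩
    ∑∉ (h ∷ u) f + ∑ W (λ g → ⟦ g ≟ h ⟧ * f g)
      ≡⟨ sym (∑-+ W _ _) ⟩
    ∑ W (λ g → free (h ∷ u) g * f g + ⟦ g ≟ h ⟧ * f g)
      ≡⟨ ∑-cong W (λ g → trans (sym (*-distribʳ-+ (f g) (free (h ∷ u) g) ⟦ g ≟ h ⟧)) (cong (_* f g) (split g))) ⟩
    ∑∉ u f ∎
    where
    open ≡-Reasoning
    off : ∀ g → g ≢ h → ⟦ g ≟ h ⟧ * f g ≡ 0
    off g g≢ rewrite ⟦⟧-false (g ≟ h) g≢ = refl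
    at : ⟦ h ≟ h ⟧ * f h ≡ f h
    at rewrite ⟦⟧-true (h ≟ h) refl = *-identityˡ (f h)
    split : ∀ g → free (h ∷ u) g + ⟦ g ≟ h ⟧ ≡ free u g
    split g = case (g ≟ h) of λ where
      (yes refl) → trans (cong₂ _+_ (⟦⟧-false (¬? (g ∈? (h ∷ u))) λ g∉ → g∉ (here refl)) (⟦⟧-true (g ≟ h) refl))
                         (sym (⟦⟧-true (¬? (g ∈? u)) h∉))
      (no g≢) → trans (cong₂ _+_
        (⟦⟧-cong (¬? (g ∈? (h ∷ u))) (¬? (g ∈? u)) (λ ∉∷ g∈ → ∉∷ (there g∈))
          λ { g∉ (here eq) → g≢ eq ; g∉ (there g∈) → g∉ g∈ })
        (⟦⟧-false (g ≟ h) g≢)) (+-identityʳ _)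

  #free-∷ : ∀ {u h} → h ∉ u → suc (#free (h ∷ u)) ≡ #free u
  #free-∷ {u} h∉ = trans (+-comm 1 _) (∑∉-∷ (λ _ → 1) h∉)

  ∑∉-swap : ∀ u (f : P → P → ℕ) →
    ∑∉ u (λ h → ∑∉ (h ∷ u) (f h)) ≡ ∑∉ u (λ g → ∑∉ (g ∷ u) (λ h → f h g))
  ∑∉-swap u f = begin
    ∑ W (λ h → free u h * ∑ W (λ g → free (h ∷ u) g * f h g))
      ≡⟨ ∑-cong W (λ h → sym (∑-*ˡ W (free u h) _)) ⟩
    ∑ W (λ h → ∑ W (λ g → free u h * (free (h ∷ u) g * f h g)))
      ≡⟨ ∑-swap W W _ ⟩
    ∑ W (λ g → ∑ W (λ h → free u h * (free (h ∷ u) g * f h g)))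
      ≡⟨ ∑-cong W (λ g → ∑-cong W λ h → exchange h g) ⟩
    ∑ W (λ g → ∑ W (λ h → free u g * (free (g ∷ u) h * f h g)))
      ≡⟨ ∑-cong W (λ g → ∑-*ˡ W (free u g) _) ⟩
    ∑ W (λ g → free u g * ∑ W (λ h → free (g ∷ u) h * f h g)) ∎
    where
    open ≡-Reasoning
    distinct : ∀ {h g} → h ∉ u × g ∉ (h ∷ u) → g ∉ u × h ∉ (g ∷ u)
    distinct (h∉ , g∉) = (λ g∈ → g∉ (there g∈)) ,
      λ { (here eq) → g∉ (here (sym eq)) ; (there h∈) → h∉ h∈ }
    exchange : ∀ h g → free u h * (free (h ∷ u) g * f h g) ≡ free u g * (free (g ∷ u) h * f h g)
    exchange h g = begin
      free u h * (free (h ∷ u) g * f h g)  ≡⟨ sym (*-assoc (free u h) _ _) ⟩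
      free u h * free (h ∷ u) g * f h g
        ≡⟨ cong (_* f h g) (trans (⟦⟧-× (¬? (h ∈? u)) (¬? (g ∈? (h ∷ u))))
             (trans (⟦⟧-cong (¬? (h ∈? u) ×-dec ¬? (g ∈? (h ∷ u))) (¬? (g ∈? u) ×-dec ¬? (h ∈? (g ∷ u))) distinct distinct) (sym (⟦⟧-× (¬? (g ∈? u)) (¬? (h ∈? (g ∷ u))))))) ⟩
      free u g * free (g ∷ u) h * f h g    ≡⟨ *-assoc (free u g) _ _ ⟩
      free u g * (free (g ∷ u) h * f h g)  ∎

  ∑∉-combine : ∀ u a b c {f g k} → (∀ h → h ∉ u → a * f h + b * g h ≤ c * k h) →
    a * ∑∉ u f + b * ∑∉ u g ≤ c * ∑∉ u k
  ∑∉-combine u a b c {f} {g} {k} le = begin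
    a * ∑∉ u f + b * ∑∉ u g                         ≡⟨ sym (cong₂ _+_ (∑∉-*ˡ u a f) (∑∉-*ˡ u b g)) ⟩
    ∑∉ u (λ h → a * f h) + ∑∉ u (λ h → b * g h)     ≡⟨ sym (∑∉-+ u _ _) ⟩
    ∑∉ u (λ h → a * f h + b * g h)                  ≤⟨ ∑∉-mono u le ⟩
    ∑∉ u (λ h → c * k h)                            ≡⟨ ∑∉-*ˡ u c k ⟩
    c * ∑∉ u k                                      ∎
    where open ≤-Reasoning

  -- Each of the m choices leaves m - 1 free points, and m (m - 1)! = m!. Only for m = 0 is the
  -- inequality strict: the sum is empty and 0! is 1.
  ∑∉-factorial : ∀ u → ∑∉ u (λ h → #free (h ∷ u) !) ≤ #free u !
  ∑∉-factorial u with #free u in eq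
  ... | zero  = ≤-trans (∑∉-mono u λ h h∉ → ⊥-elim (1+n≢0 (trans (#free-∷ h∉) eq)))
                        (≤-trans (≤-reflexive eq) z≤n)
  ... | suc m = begin
    ∑∉ u (λ h → #free (h ∷ u) !)  ≡⟨ ∑∉-cong u (λ h h∉ → cong _! (suc-injective (trans (#free-∷ h∉) eq))) ⟩
    ∑∉ u (λ _ → m !)              ≡⟨ ∑∉-const u (m !) ⟩
    m ! * #free u                 ≡⟨ cong (m ! *_) eq ⟩
    m ! * suc m                   ≡⟨ *-comm (m !) (suc m) ⟩
    suc m * m !                   ∎
    where open ≤-Reasoning

  Functional : Set
  Functional = List P → List (P × P) → ℕ

  -- match joins two random free points by an edge; kill uses up one random
  -- free point and, with probability 2/3, puts a loop on it.  Both are sums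
  -- instead of averages.
  match kill : Functional → Functional
  match Y u G = ∑∉ u λ h → ∑∉ (h ∷ u) λ h′ → Y (h′ ∷ h ∷ u) ((h , h′) ∷ G)
  kill  Y u G = ∑∉ u λ h → Y (h ∷ u) G + 2 * Y (h ∷ u) ((h , h) ∷ G)

  -- Dependence on the sets of used points and revealed edges alone, so that the order of the draws
  -- may be changed.
  Symmetric : Functional → Set
  Symmetric Y = ∀ {u u′ G G′} → u ≋ u′ → G ≋ G′ → Y u G ≡ Y u′ G′

  kill-symmetric : ∀ {Y} → Symmetric Y → Symmetric (kill Y)
  kill-symmetric Y-sym {u} u≋ G≋ = trans
    (∑∉-cong u λ h _ → cong₂ (λ a b → a + 2 * b) (Y-sym (≋-∷ h u≋) G≋) (Y-sym (≋-∷ h u≋) (≋-∷ _ G≋)))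
    (∑∉-≋ u≋ _)

  kill-cong : ∀ {Y Y′} → (∀ u G → Y u G ≡ Y′ u G) → ∀ u G → kill Y u G ≡ kill Y′ u G
  kill-cong eq u G = ∑∉-cong u λ h _ → cong₂ (λ a b → a + 2 * b) (eq _ _) (eq _ _)

  match-cong : ∀ {Y Y′} → (∀ u G → Y u G ≡ Y′ u G) → ∀ u G → match Y u G ≡ match Y′ u G
  match-cong eq u G = ∑∉-cong u λ h _ → ∑∉-cong (h ∷ u) λ h′ _ → eq _ _

  kill-mono : ∀ {Y Y′} → (∀ u G → Y u G ≤ Y′ u G) → ∀ u G → kill Y u G ≤ kill Y′ u G
  kill-mono le u G = ∑∉-mono u λ h _ → +-mono-≤ (le _ _) (*-monoʳ-≤ 2 (le _ _))

  match-mono : ∀ {Y Y′} → (∀ u G → Y u G ≤ Y′ u G) → ∀ u G → match Y u G ≤ match Y′ u G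
  match-mono le u G = ∑∉-mono u λ h _ → ∑∉-mono (h ∷ u) λ h′ _ → le _ _

  -- Both sides draw three distinct points. Two exchanges of sums move the killed point from the
  -- first place to the last, and symmetry of `Y` absorbs the new order of the lists.
  kill-match : ∀ {Y} → Symmetric Y → ∀ u G → kill (match Y) u G ≡ match (kill Y) u G
  kill-match {Y} Y-sym u G = begin
    ∑∉ u (λ g → match Y (g ∷ u) G + 2 * match Y (g ∷ u) ((g , g) ∷ G))
      ≡⟨ ∑∉-cong u (λ g _ → collect g) ⟩
    ∑∉ u (λ g → ∑∉ (g ∷ u) λ h → ∑∉ (h ∷ g ∷ u) (E g h))
      ≡⟨ ∑∉-swap u _ ⟩
    ∑∉ u (λ h → ∑∉ (h ∷ u) λ g → ∑∉ (h ∷ g ∷ u) (E g h))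
      ≡⟨ ∑∉-cong u (λ h _ → ∑∉-cong (h ∷ u) λ g _ → ∑∉-≋ (≋-swap {xs = u} h g) (E g h)) ⟩
    ∑∉ u (λ h → ∑∉ (h ∷ u) λ g → ∑∉ (g ∷ h ∷ u) (E g h))
      ≡⟨ ∑∉-cong u (λ h _ → ∑∉-swap (h ∷ u) (λ g → E g h)) ⟩
    ∑∉ u (λ h → ∑∉ (h ∷ u) λ h′ → ∑∉ (h′ ∷ h ∷ u) λ g → E g h h′)
      ≡⟨ ∑∉-cong u (λ h _ → ∑∉-cong (h ∷ u) λ h′ _ → ∑∉-cong (h′ ∷ h ∷ u) λ g _ →
           cong₂ (λ a b → a + 2 * b)
             (Y-sym {G = (h , h′) ∷ G} (rotate g h h′) ≋-refl)
             (Y-sym (rotate g h h′) (≋-swap _ _))) ⟩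
    match (kill Y) u G ∎
    where
    open ≡-Reasoning
    E : P → P → P → ℕ
    E g h h′ = Y (h′ ∷ h ∷ g ∷ u) ((h , h′) ∷ G) + 2 * Y (h′ ∷ h ∷ g ∷ u) ((h , h′) ∷ (g , g) ∷ G)
    rotate : ∀ g h h′ → (h′ ∷ h ∷ g ∷ u) ≋ (g ∷ h′ ∷ h ∷ u)
    rotate g h h′ = ≋-trans (≋-∷ h′ (≋-swap h g)) (≋-swap h′ g)
    collect : ∀ g → match Y (g ∷ u) G + 2 * match Y (g ∷ u) ((g , g) ∷ G) ≡
                    ∑∉ (g ∷ u) (λ h → ∑∉ (h ∷ g ∷ u) (E g h))
    collect g = begin
      match Y (g ∷ u) G + 2 * match Y (g ∷ u) ((g , g) ∷ G)
        ≡⟨ cong (match Y (g ∷ u) G +_) (sym (∑∉-*ˡ (g ∷ u) 2 _)) ⟩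
      _ ≡⟨ sym (∑∉-+ (g ∷ u) _ _) ⟩
      _ ≡⟨ ∑∉-cong (g ∷ u) (λ h _ →
          trans (cong (∑∉ (h ∷ g ∷ u) (λ h′ → Y (h′ ∷ h ∷ g ∷ u) ((h , h′) ∷ G)) +_)
                  (sym (∑∉-*ˡ (h ∷ g ∷ u) 2 (λ h′ → Y (h′ ∷ h ∷ g ∷ u) ((h , h′) ∷ (g , g) ∷ G)))))
                (sym (∑∉-+ (h ∷ g ∷ u) _ _))) ⟩
      ∑∉ (g ∷ u) (λ h → ∑∉ (h ∷ g ∷ u) (E g h)) ∎

  explore : ℕ → ℕ → Functional → Functional
  explore k f Y = iterate k match (iterate f kill Y)

  iterate-cong : ∀ k {Y Y′} → (∀ u G → Y u G ≡ Y′ u G) →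
    ∀ u G → iterate k match Y u G ≡ iterate k match Y′ u G
  iterate-cong zero    eq = eq
  iterate-cong (suc k) eq = iterate-cong k (match-cong eq)

  kills-match : ∀ f {Y} → Symmetric Y → ∀ u G →
    iterate f kill (match Y) u G ≡ match (iterate f kill Y) u G
  kills-match zero    Y-sym u G = refl
  kills-match (suc f) {Y} Y-sym u G =
    trans (iterate-kill-cong f (kill-match Y-sym) u G) (kills-match f (kill-symmetric Y-sym) u G)
    where
    iterate-kill-cong : ∀ k {Y Y′} → (∀ u G → Y u G ≡ Y′ u G) →
      ∀ u G → iterate k kill Y u G ≡ iterate k kill Y′ u G
    iterate-kill-cong zero    eq = eq
    iterate-kill-cong (suc k) eq = iterate-kill-cong k (kill-cong eq)

  -- The interpolation inequality produces a match at the innermost place, after all kills;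
  -- commutation brings it back among the other matches, so that two counters describe every term of
  -- the iteration.
  explore-match : ∀ k f {Y} → Symmetric Y → ∀ u G →
    explore k f (match Y) u G ≡ explore (suc k) f Y u G
  explore-match k f Y-sym = iterate-cong k (kills-match f Y-sym)

  Bound : ℕ → (a b c : ℕ) → (Y Y′ Y″ : Functional) → Set
  Bound m a b c Y Y′ Y″ = ∀ u G → m ≤ #free u → a * Y u G + b * Y′ u G ≤ c * Y″ u G

  private
    step : ∀ {m u h} → h ∉ u → suc m ≤ #free u → m ≤ #free (h ∷ u)
    step h∉ le = ≤-pred (≤-trans le (≤-reflexive (sym (#free-∷ h∉))))

  kill-bound : ∀ {m a b c Y Y′ Y″} → Bound m a b c Y Y′ Y″ →
    Bound (suc m) a b c (kill Y) (kill Y′) (kill Y″)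
  kill-bound {a = a} {b} {c} bd u G m≤ = ∑∉-combine u a b c λ h h∉ →
    combine (bd (h ∷ u) G (step h∉ m≤)) (bd (h ∷ u) ((h , h) ∷ G) (step h∉ m≤))
    where
    left : ∀ a b p p′ q q′ → a * (p + 2 * p′) + b * (q + 2 * q′) ≡ (a * p + b * q) + 2 * (a * p′ + b * q′)
    left = solve-∀
    right : ∀ c r r′ → c * r + 2 * (c * r′) ≡ c * (r + 2 * r′)
    right = solve-∀
    combine : ∀ {p p′ q q′ r r′} → a * p + b * q ≤ c * r → a * p′ + b * q′ ≤ c * r′ →
      a * (p + 2 * p′) + b * (q + 2 * q′) ≤ c * (r + 2 * r′)
    combine {p} {p′} {q} {q′} {r} {r′} i j = ≤-trans (≤-reflexive (left a b p p′ q q′))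
      (≤-trans (+-mono-≤ i (*-monoʳ-≤ 2 j)) (≤-reflexive (right c r r′)))

  match-bound : ∀ {m a b c Y Y′ Y″} → Bound m a b c Y Y′ Y″ →
    Bound (suc (suc m)) a b c (match Y) (match Y′) (match Y″)
  match-bound {a = a} {b} {c} bd u G m≤ = ∑∉-combine u a b c λ h h∉ →
    ∑∉-combine (h ∷ u) a b c λ h′ h′∉ → bd _ _ (step h′∉ (step h∉ m≤))

  -- Sums with nonnegative coefficients preserve a linear inequality. `m` points must still be free
  -- when it is used, hence one more at the start for each kill and two more for each match.
  explore-bound : ∀ k f {m a b c Y Y′ Y″} → Bound m a b c Y Y′ Y″ →
    Bound (k * 2 + (f + m)) a b c (explore k f Y) (explore k f Y′) (explore k f Y″)
  explore-bound k f {m} {a} {b} {c} {Y} {Y′} {Y″} bd = matches k (kills f {m} {Y} {Y′} {Y″} bd)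
    where
    kills : ∀ f {m Y Y′ Y″} → Bound m a b c Y Y′ Y″ →
      Bound (f + m) a b c (iterate f kill Y) (iterate f kill Y′) (iterate f kill Y″)
    kills zero    bd = bd
    kills (suc f) {m} {Y} {Y′} {Y″} bd rewrite sym (+-suc f m) = kills f (kill-bound {a = a} {b} {c} {Y} {Y′} {Y″} bd)
    matches : ∀ k {m Y Y′ Y″} → Bound m a b c Y Y′ Y″ →
      Bound (k * 2 + m) a b c (iterate k match Y) (iterate k match Y′) (iterate k match Y″)
    matches zero    bd = bd
    matches (suc k) {m} {Y} {Y′} {Y″} bd rewrite trans (cong suc (sym (+-suc (k * 2) m))) (sym (+-suc (k * 2) (suc m))) =
      matches k (match-bound {a = a} {b} {c} {Y} {Y′} {Y″} bd)

-- Lattice paths and Catalan numbers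

module Ballot (S : ℕ → ℕ → ℕ) (a b c K : ℕ)
  (step : ∀ k f → k * 2 + f ≤ K * 2 → a * S (suc k) f + b * S k f ≤ c * S k (suc f)) where

  private
    used≤ : ∀ k v d {f} → f ≡ v * 2 + d → k + (v + d) ≡ K → k * 2 + f ≤ K * 2
    used≤ k v d refl refl = ≤-trans (m≤m+n _ d) (≤-reflexive (lemma k v d))
      where
      lemma : ∀ k v d → k * 2 + (v * 2 + d) + d ≡ (k + (v + d)) * 2
      lemma = solve-∀

    matchStep : ∀ k f → k * 2 + f ≤ K * 2 → a * S (suc k) f ≤ c * S k (suc f)
    matchStep k f u = ≤-trans (m≤m+n _ _) (step k f u)

    dropStep : ∀ k f → k * 2 + f ≤ K * 2 → b * S k f ≤ c * S k (suc f)
    dropStep k f u = ≤-trans (m≤n+m _ _) (step k f u)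

  open ≤-Reasoning

  -- Iterating `step` gives a sum over lattice paths from (k , f) to (K , 0)
  -- along which k * 2 + f never exceeds K * 2.  With v steps (k , f) and
  -- w = v + d steps (suc k , f) these are counted by the ballot number
  -- f! (d + 1) / (v! (w + 1)!).
  ballot : ∀ v d k f w → f ≡ v * 2 + d → w ≡ v + d → k + w ≡ K →
    f ! * suc d * a ^ w * b ^ v * S K 0 ≤ c ^ f * v ! * (suc w) ! * S k f
  ballot zero zero k f w refl refl k+w≡K rewrite trans (sym (+-identityʳ k)) k+w≡K = ≤-refl
  -- No drop is pending, so the rest of the path is forced.
  ballot zero (suc d) k (suc f) (suc w) refl refl k+w≡K = begin
    (suc f * f !) * suc (suc d) * (a * a ^ w) * 1 * S K 0
      ≡⟨ left d (f !) a (a ^ w) (S K 0) ⟩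
    (a * suc (suc d)) * (f ! * suc d * a ^ w * 1 * S K 0)
      ≤⟨ *-monoʳ-≤ (a * suc (suc d)) (ballot zero d (suc k) f w refl refl (trans (sym (+-suc k w)) k+w≡K)) ⟩
    (a * suc (suc d)) * (c ^ f * 1 * (suc w) ! * S (suc k) f)
      ≡⟨ middle a (suc (suc d)) (c ^ f) ((suc w) !) (S (suc k) f) ⟩
    (c ^ f * 1 * (suc (suc d) * (suc w) !)) * (a * S (suc k) f)
      ≤⟨ *-monoʳ-≤ (c ^ f * 1 * (suc (suc d) * (suc w) !)) (matchStep k f (≤-trans (+-monoʳ-≤ (k * 2) (n≤1+n f)) (used≤ k 0 (suc d) refl k+w≡K))) ⟩
    (c ^ f * 1 * (suc (suc d) * (suc w) !)) * (c * S k (suc f))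
      ≡⟨ right c (suc (suc d)) (c ^ f) ((suc w) !) (S k (suc f)) ⟩
    (c * c ^ f) * 1 * (suc (suc d) * (suc w) !) * S k (suc f) ∎
    where
    left : ∀ d F a A s → (suc d * F) * suc (suc d) * (a * A) * 1 * s ≡ (a * suc (suc d)) * (F * suc d * A * 1 * s)
    left = solve-∀
    middle : ∀ a e C W s → (a * e) * (C * 1 * W * s) ≡ (C * 1 * (e * W)) * (a * s)
    middle = solve-∀
    right : ∀ c e C W s → (C * 1 * (e * W)) * (c * s) ≡ (c * C) * 1 * (e * W) * s
    right = solve-∀
  -- The budget is used up, and a match would exceed it by one point; only a drop is possible.
  ballot (suc v) zero k (suc f) (suc w) f≡ w≡ k+w≡K = begin
    (suc f * f !) * 1 * (a ^ suc w) * (b * b ^ v) * S K 0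
      ≡⟨ cong (λ x → (x * f !) * 1 * (a ^ suc w) * (b * b ^ v) * S K 0) (trans f≡ (+-identityʳ _)) ⟩
    (suc v * 2 * f !) * 1 * (a ^ suc w) * (b * b ^ v) * S K 0
      ≡⟨ left v (f !) (a ^ suc w) b (b ^ v) (S K 0) ⟩
    (b * suc v) * (f ! * 2 * a ^ suc w * b ^ v * S K 0)
      ≤⟨ *-monoʳ-≤ (b * suc v) (ballot v 1 k f (suc w) f≡′ w≡′ k+w≡K) ⟩
    (b * suc v) * (c ^ f * v ! * (suc (suc w)) ! * S k f)
      ≡⟨ middle b (suc v) (c ^ f) (v !) ((suc (suc w)) !) (S k f) ⟩
    (c ^ f * (suc v * v !) * (suc (suc w)) !) * (b * S k f)
      ≤⟨ *-monoʳ-≤ (c ^ f * (suc v * v !) * (suc (suc w)) !) (dropStep k f (used≤ k v 1 f≡′ (trans (cong (k +_) (sym w≡′)) k+w≡K))) ⟩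
    (c ^ f * (suc v * v !) * (suc (suc w)) !) * (c * S k (suc f))
      ≡⟨ right c (suc v) (c ^ f) (v !) ((suc (suc w)) !) (S k (suc f)) ⟩
    (c * c ^ f) * (suc v * v !) * (suc (suc w)) ! * S k (suc f) ∎
    where
    f≡′ : f ≡ v * 2 + 1
    f≡′ = suc-injective (trans f≡ (lemma v))
      where
      lemma : ∀ v → suc v * 2 + 0 ≡ suc (v * 2 + 1)
      lemma = solve-∀
    w≡′ : suc w ≡ v + 1
    w≡′ = trans w≡ (lemma v)
      where
      lemma : ∀ v → suc v + 0 ≡ v + 1
      lemma = solve-∀
    left : ∀ v F A b B s → (suc v * 2 * F) * 1 * A * (b * B) * s ≡ (b * suc v) * (F * 2 * A * B * s)
    left = solve-∀
    middle : ∀ b e C V W s → (b * e) * (C * V * W * s) ≡ (C * (e * V) * W) * (b * s)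
    middle = solve-∀
    right : ∀ c e C V W s → (C * (e * V) * W) * (c * s) ≡ (c * C) * (e * V) * W * s
    right = solve-∀
  -- Either step is possible. Cleared of factorials, the recursion of the ballot numbers is (2 v +
  -- d) (d + 1) = (v + d + 1) d + v (d + 2), read here at `suc v` and `suc d`.
  ballot (suc v) (suc d) k (suc f) (suc w) f≡ w≡ k+w≡K = begin
    (suc f * f !) * suc (suc d) * (a * a ^ w) * (b * b ^ v) * S K 0
      ≡⟨ cong (λ x → (x * f !) * suc (suc d) * (a * a ^ w) * (b * b ^ v) * S K 0) f≡ ⟩
    ((suc v * 2 + suc d) * f !) * suc (suc d) * (a * a ^ w) * (b * b ^ v) * S K 0
      ≡⟨ left v d (f !) a (a ^ w) b (b ^ v) (S K 0) ⟩
    (a * suc (suc v + suc d)) * (f ! * suc d * a ^ w * (b * b ^ v) * S K 0) +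
    (b * suc v) * (f ! * suc (suc (suc d)) * (a * a ^ w) * b ^ v * S K 0)
      ≡⟨ cong (λ x → (a * suc x) * (f ! * suc d * a ^ w * (b * b ^ v) * S K 0) +
               (b * suc v) * (f ! * suc (suc (suc d)) * (a * a ^ w) * b ^ v * S K 0)) (sym w≡) ⟩
    (a * suc (suc w)) * (f ! * suc d * a ^ w * (b * b ^ v) * S K 0) +
    (b * suc v) * (f ! * suc (suc (suc d)) * (a * a ^ w) * b ^ v * S K 0)
      ≤⟨ +-mono-≤
           (*-monoʳ-≤ (a * suc (suc w)) (ballot (suc v) d (suc k) f w f≡₁ w≡₁ (trans (sym (+-suc k w)) k+w≡K)))
           (*-monoʳ-≤ (b * suc v) (ballot v (suc (suc d)) k f (suc w) f≡₂ w≡₂ k+w≡K)) ⟩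
    (a * suc (suc w)) * (c ^ f * (suc v * v !) * (suc w) ! * S (suc k) f) +
    (b * suc v) * (c ^ f * v ! * (suc (suc w) * (suc w) !) * S k f)
      ≡⟨ middle a b (suc (suc w)) (c ^ f) (suc v) (v !) ((suc w) !) (S (suc k) f) (S k f) ⟩
    (c ^ f * (suc v * v !) * (suc (suc w) * (suc w) !)) * (a * S (suc k) f + b * S k f)
      ≤⟨ *-monoʳ-≤ (c ^ f * (suc v * v !) * (suc (suc w) * (suc w) !)) (step k f (used≤ k v (suc (suc d)) f≡₂ (trans (cong (k +_) (sym w≡₂)) k+w≡K))) ⟩
    (c ^ f * (suc v * v !) * (suc (suc w) * (suc w) !)) * (c * S k (suc f))
      ≡⟨ right c (suc v) (c ^ f) (v !) ((suc (suc w)) !) (S k (suc f)) ⟩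
    (c * c ^ f) * (suc v * v !) * (suc (suc w)) ! * S k (suc f) ∎
    where
    f≡₁ : f ≡ suc v * 2 + d
    f≡₁ = suc-injective (trans f≡ (+-suc (suc v * 2) d))
    f≡₂ : f ≡ v * 2 + suc (suc d)
    f≡₂ = trans f≡₁ (lemma v d)
      where
      lemma : ∀ v d → suc v * 2 + d ≡ v * 2 + suc (suc d)
      lemma = solve-∀
    w≡₁ : w ≡ suc v + d
    w≡₁ = suc-injective (trans w≡ (+-suc (suc v) d))
    w≡₂ : suc w ≡ v + suc (suc d)
    w≡₂ = trans w≡ (lemma v d)
      where
      lemma : ∀ v d → suc v + suc d ≡ v + suc (suc d)
      lemma = solve-∀
    left : ∀ v d F a A b B s → ((suc v * 2 + suc d) * F) * suc (suc d) * (a * A) * (b * B) * s ≡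
      (a * suc (suc v + suc d)) * (F * suc d * A * (b * B) * s) + (b * suc v) * (F * suc (suc (suc d)) * (a * A) * B * s)
    left = solve-∀
    middle : ∀ a b e C g V W s t → (a * e) * (C * (g * V) * W * s) + (b * g) * (C * V * (e * W) * t) ≡
      (C * (g * V) * (e * W)) * (a * s + b * t)
    middle = solve-∀
    right : ∀ c e C V W s → (C * (e * V) * W) * (c * s) ≡ (c * C) * (e * V) * W * s
    right = solve-∀

-- Consecutive Catalan numbers (2 K)! / (K! (K + 1)!) have ratio 2 (2 K + 1) / (K + 2), slightly
-- below 4. The square of `suc K` absorbs the deficit because 2 (K + 1)² ≤ (K + 2) (2 K + 1).
catalan-bound : ∀ K → 4 ^ K * K ! * (suc K) ! ≤ suc K * suc K * (K * 2) !
catalan-bound zero    = ≤-refl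
catalan-bound (suc K) = begin
  (4 * 4 ^ K) * (suc K * K !) * (suc (suc K) * (suc K) !)
    ≡⟨ left K (4 ^ K) (K !) ((suc K) !) ⟩
  (4 * suc K * suc (suc K)) * (4 ^ K * K ! * (suc K) !)
    ≤⟨ *-monoʳ-≤ (4 * suc K * suc (suc K)) (catalan-bound K) ⟩
  (4 * suc K * suc (suc K)) * (suc K * suc K * (K * 2) !)
    ≡⟨ middle K ((K * 2) !) ⟩
  (2 * (suc K * suc K)) * (2 * suc K * suc (suc K) * (K * 2) !)
    ≤⟨ *-monoˡ-≤ _ (≤-trans (m≤m+n _ K) (≤-reflexive (slack K))) ⟩
  (suc (suc K) * suc (K * 2)) * (2 * suc K * suc (suc K) * (K * 2) !)
    ≡⟨ right K ((K * 2) !) ⟩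
  suc (suc K) * suc (suc K) * (suc (suc (K * 2)) * (suc (K * 2) * (K * 2) !)) ∎
  where
  open ≤-Reasoning
  left : ∀ K p q r → (4 * p) * (suc K * q) * (suc (suc K) * r) ≡ (4 * suc K * suc (suc K)) * (p * q * r)
  left = solve-∀
  middle : ∀ K F → (4 * suc K * suc (suc K)) * (suc K * suc K * F) ≡ (2 * (suc K * suc K)) * (2 * suc K * suc (suc K) * F)
  middle = solve-∀
  slack : ∀ K → 2 * (suc K * suc K) + K ≡ suc (suc K) * suc (K * 2)
  slack = solve-∀
  right : ∀ K F → (suc (suc K) * suc (K * 2)) * (2 * suc K * suc (suc K) * F) ≡
    suc (suc K) * suc (suc K) * (suc (suc (K * 2)) * (suc (K * 2) * F))
  right = solve-∀

-- Numerical inequalities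

-- 375 c² − 500 c x + (500/3) x² is a third of 125 (3 c − 2 x)²; since 167
-- exceeds 500/3, the terms linear in c and x are absorbed once x is large.
quadratic : ∀ c x → 299 ≤ x → 500 * (c * x) + 375 * c ≤ 167 * (x * suc x) + 375 * (c * c)
-- Over the naturals, (3 c - 2 x)² is expanded as w², with w the difference of the larger and the
-- smaller of 3 c and 2 x.
quadratic c x 299≤x = *-cancelˡ-≤ 3 (case′ (≤-total (3 * c) (2 * x)))
  where
  open ≤-Reasoning
  case′ : _ → 3 * (500 * (c * x) + 375 * c) ≤ 3 * (167 * (x * suc x) + 375 * (c * c))
  case′ (inj₁ 3c≤2x) with m≤n⇒∃[o]m+o≡n 3c≤2x
  ... | w , eq = *-cancelˡ-≤ 4 (begin
    4 * (3 * (500 * (c * x) + 375 * c))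
      ≡⟨ l₁ c x ⟩
    3000 * c * (2 * x) + 4500 * c
      ≡⟨ cong (λ y → 3000 * c * y + 4500 * c) (sym eq) ⟩
    3000 * c * (3 * c + w) + 4500 * c
      ≤⟨ +-monoʳ-≤ (3000 * c * (3 * c + w)) (≤-trans (≤-reflexive (l₂ c)) (*-monoʳ-≤ 1500 3c≤2x)) ⟩
    3000 * c * (3 * c + w) + 1500 * (2 * x)
      ≤⟨ +-monoʳ-≤ (3000 * c * (3 * c + w)) (≤-trans (≤-reflexive (l₅ x)) (*-monoˡ-≤ x (≤-trans (m≤m+n 3000 200) (ground x 299≤x)))) ⟩
    3000 * c * (3 * c + w) + (4 * x + 2004) * x
      ≤⟨ +-monoˡ-≤ ((4 * x + 2004) * x) (m≤m+n (3000 * c * (3 * c + w)) (500 * (w * w))) ⟩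
    (3000 * c * (3 * c + w) + 500 * (w * w)) + (4 * x + 2004) * x
      ≡⟨ cong (_+ (4 * x + 2004) * x) (l₃ c w) ⟩
    (500 * ((3 * c + w) * (3 * c + w)) + 4500 * (c * c)) + (4 * x + 2004) * x
      ≡⟨ cong (λ y → (500 * (y * y) + 4500 * (c * c)) + (4 * x + 2004) * x) eq ⟩
    (500 * ((2 * x) * (2 * x)) + 4500 * (c * c)) + (4 * x + 2004) * x
      ≡⟨ l₄ c x ⟩
    4 * (3 * (167 * (x * suc x) + 375 * (c * c))) ∎)
    where
    l₁ : ∀ c x → 4 * (3 * (500 * (c * x) + 375 * c)) ≡ 3000 * c * (2 * x) + 4500 * c
    l₁ = solve-∀
    l₂ : ∀ c → 4500 * c ≡ 1500 * (3 * c)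
    l₂ = solve-∀
    l₃ : ∀ c w → 3000 * c * (3 * c + w) + 500 * (w * w) ≡ 500 * ((3 * c + w) * (3 * c + w)) + 4500 * (c * c)
    l₃ = solve-∀
    l₄ : ∀ c x → (500 * ((2 * x) * (2 * x)) + 4500 * (c * c)) + (4 * x + 2004) * x ≡
                 4 * (3 * (167 * (x * suc x) + 375 * (c * c)))
    l₄ = solve-∀
    l₅ : ∀ x → 1500 * (2 * x) ≡ 3000 * x
    l₅ = solve-∀
    ground : ∀ x → 299 ≤ x → 3200 ≤ 4 * x + 2004
    ground x le = +-monoˡ-≤ 2004 (*-monoʳ-≤ 4 le)
  case′ (inj₂ 2x≤3c) with m≤n⇒∃[o]m+o≡n 2x≤3c
  ... | w , eq = begin
    3 * (500 * (c * x) + 375 * c)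
      ≡⟨ l₁ c x ⟩
    (500 * x + 375) * (3 * c)
      ≡⟨ cong ((500 * x + 375) *_) (sym eq) ⟩
    (500 * x + 375) * (2 * x + w)
      ≡⟨ l₂ x w ⟩
    (1000 * (x * x) + 500 * (x * w) + 501 * x) + (249 * x + 375 * w)
      ≤⟨ +-monoʳ-≤ (1000 * (x * x) + 500 * (x * w) + 501 * x) (tail w) ⟩
    (1000 * (x * x) + 500 * (x * w) + 501 * x) + (x * x + 125 * (w * w))
      ≡⟨ l₃ x w ⟩
    501 * (x * suc x) + 125 * ((2 * x + w) * (2 * x + w))
      ≡⟨ cong (λ y → 501 * (x * suc x) + 125 * (y * y)) eq ⟩
    501 * (x * suc x) + 125 * ((3 * c) * (3 * c))
      ≡⟨ l₄ c x ⟩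
    3 * (167 * (x * suc x) + 375 * (c * c)) ∎
    where
    l₁ : ∀ c x → 3 * (500 * (c * x) + 375 * c) ≡ (500 * x + 375) * (3 * c)
    l₁ = solve-∀
    l₂ : ∀ x w → (500 * x + 375) * (2 * x + w) ≡ (1000 * (x * x) + 500 * (x * w) + 501 * x) + (249 * x + 375 * w)
    l₂ = solve-∀
    l₃ : ∀ x w → (1000 * (x * x) + 500 * (x * w) + 501 * x) + (x * x + 125 * (w * w)) ≡
                 501 * (x * suc x) + 125 * ((2 * x + w) * (2 * x + w))
    l₃ = solve-∀
    l₄ : ∀ c x → 501 * (x * suc x) + 125 * ((3 * c) * (3 * c)) ≡ 3 * (167 * (x * suc x) + 375 * (c * c))
    l₄ = solve-∀
    l₆ : ∀ x → 249 * x + 50 * x ≡ 299 * x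
    l₆ = solve-∀
    l₇ : ∀ w → 375 * w ≡ 125 * (3 * w)
    l₇ = solve-∀
    -- From w = 3 on, 125 w² pays for 375 w. For smaller w that term is at most 1125 ≤ 50 x, which
    -- makes 249 + 50 = 299 the bound required of x.
    tail : ∀ w → 249 * x + 375 * w ≤ x * x + 125 * (w * w)
    tail w with ≤-total w 3
    ... | inj₂ 3≤w = +-mono-≤ (*-monoˡ-≤ x (≤-trans (m≤m+n 249 50) 299≤x))
                              (≤-trans (≤-reflexive (l₇ w)) (*-monoʳ-≤ 125 (*-monoˡ-≤ w 3≤w)))
    ... | inj₁ w≤3 = begin
      249 * x + 375 * w       ≤⟨ +-monoʳ-≤ (249 * x) (≤-trans (*-monoʳ-≤ 375 w≤3) (≤-trans (m≤m+n 1125 13825) (*-monoʳ-≤ 50 299≤x))) ⟩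
      249 * x + 50 * x        ≡⟨ l₆ x ⟩
      299 * x                 ≤⟨ *-monoˡ-≤ x 299≤x ⟩
      x * x                   ≤⟨ m≤m+n _ _ ⟩
      x * x + 125 * (w * w)   ∎

-- Bernoulli's inequality for 1 + 1/50. `strong` keeps the constant 50 because an induction on
-- `suc l` alone would break for l below 49.
bernoulli : ∀ l → suc l * 50 ^ l ≤ 50 * 51 ^ l
bernoulli l = ≤-trans (*-monoˡ-≤ (50 ^ l) (s≤s (m≤n+m l 49))) (strong l)
  where
  open ≤-Reasoning
  l₁ : ∀ l p → (50 + suc l) * (50 * p) ≡ (2550 + 50 * l) * p
  l₁ = solve-∀
  l₂ : ∀ l p → (2550 + 51 * l) * p ≡ 51 * ((50 + l) * p)
  l₂ = solve-∀
  strong : ∀ l → (50 + l) * 50 ^ l ≤ 50 * 51 ^ l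
  strong zero    = ≤-refl
  strong (suc l) = begin
    (50 + suc l) * (50 * 50 ^ l)  ≡⟨ l₁ l (50 ^ l) ⟩
    (2550 + 50 * l) * 50 ^ l      ≤⟨ *-monoˡ-≤ (50 ^ l) (+-monoʳ-≤ 2550 (*-monoˡ-≤ l (n≤1+n 50))) ⟩
    (2550 + 51 * l) * 50 ^ l      ≡⟨ l₂ l (50 ^ l) ⟩
    51 * ((50 + l) * 50 ^ l)      ≤⟨ *-monoʳ-≤ 51 (strong l) ⟩
    51 * (50 * 51 ^ l)            ≡⟨ *-left-comm 51 50 (51 ^ l) ⟩
    50 * (51 * 51 ^ l)            ∎

^-distribˡ-* : ∀ m n l → (m * n) ^ l ≡ m ^ l * n ^ l
^-distribˡ-* m n zero    = refl
^-distribˡ-* m n (suc l) rewrite ^-distribˡ-* m n l = lemma m n (m ^ l) (n ^ l)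
  where
  lemma : ∀ m n p q → m * n * (p * q) ≡ m * p * (n * q)
  lemma = solve-∀

^-distribˡ-cube : ∀ m l → (m * m * m) ^ l ≡ m ^ l * m ^ l * m ^ l
^-distribˡ-cube m l = trans (^-distribˡ-* (m * m) m l) (cong (_* m ^ l) (^-distribˡ-* m m l))

-- If P exceeds Q by the factor (b / a)³, each of its three factors b / a pays for one factor
-- `suc l`; multiplying by the cube of `a ^ l` avoids division.
cubic≤exponential : ∀ a b .{{_ : NonZero a}} P Q → (∀ l → suc l * a ^ l ≤ a * b ^ l) →
  Q * (b * b * b) ≤ P * (a * a * a) → ∀ l →
  suc l * suc l * suc l * Q ^ l ≤ a * a * a * P ^ l
cubic≤exponential a b P Q bern Q≤P l = *-cancelʳ-≤ _ _ (A * A * A) {{A³≢0}} (begin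
  suc l * suc l * suc l * Q ^ l * (A * A * A)
    ≡⟨ l₁ (suc l) (Q ^ l) A ⟩
  Q ^ l * ((suc l * A) * (suc l * A) * (suc l * A))
    ≤⟨ *-monoʳ-≤ (Q ^ l) (*-mono-≤ (*-mono-≤ (bern l) (bern l)) (bern l)) ⟩
  Q ^ l * ((a * B) * (a * B) * (a * B))
    ≡⟨ l₂ a (Q ^ l) B ⟩
  a * a * a * (Q ^ l * (B * B * B))
    ≡⟨ cong (λ x → a * a * a * (Q ^ l * x)) (sym (^-distribˡ-cube b l)) ⟩
  a * a * a * (Q ^ l * (b * b * b) ^ l)
    ≡⟨ cong (a * a * a *_) (sym (^-distribˡ-* Q (b * b * b) l)) ⟩
  a * a * a * (Q * (b * b * b)) ^ l
    ≤⟨ *-monoʳ-≤ (a * a * a) (^-monoˡ-≤ l Q≤P) ⟩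
  a * a * a * (P * (a * a * a)) ^ l
    ≡⟨ cong (a * a * a *_) (trans (^-distribˡ-* P (a * a * a) l) (cong (P ^ l *_) (^-distribˡ-cube a l))) ⟩
  a * a * a * (P ^ l * (A * A * A))
    ≡⟨ sym (*-assoc (a * a * a) (P ^ l) (A * A * A)) ⟩
  a * a * a * P ^ l * (A * A * A) ∎)
  where
  open ≤-Reasoning
  A B : ℕ
  A = a ^ l
  B = b ^ l
  A³≢0 : NonZero (A * A * A)
  A³≢0 = m*n≢0 (A * A) A {{m*n≢0 A A {{m^n≢0 a l}} {{m^n≢0 a l}}}} {{m^n≢0 a l}}
  l₁ : ∀ s q p → s * s * s * q * (p * p * p) ≡ q * ((s * p) * (s * p) * (s * p))
  l₁ = solve-∀
  l₂ : ∀ a q p → q * ((a * p) * (a * p) * (a * p)) ≡ a * a * a * (q * (p * p * p))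
  l₂ = solve-∀

-- Sublists, independent sets and frozen vertices

⊑⇒∈sublists : {A : Set} {S L : List A} → S ⊑ L → S ∈ sublists L
⊑⇒∈sublists []          = here refl
⊑⇒∈sublists (y ∷ʳ s)    = ∈-++⁺ʳ (map (y ∷_) _) (⊑⇒∈sublists s)
⊑⇒∈sublists (refl ∷ s)  = ∈-++⁺ˡ (∈-map⁺ (_ ∷_) (⊑⇒∈sublists s))

∈sublists⇒⊑ : {A : Set} {S : List A} (L : List A) → S ∈ sublists L → S ⊑ L
∈sublists⇒⊑ []      (here refl) = []
∈sublists⇒⊑ (x ∷ L) S∈ with ∈-++⁻ (map (x ∷_) (sublists L)) S∈
... | inj₂ q = x ∷ʳ ∈sublists⇒⊑ L q
... | inj₁ p with ∈-map⁻ (x ∷_) p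
...   | S′ , S′∈ , refl = refl ∷ ∈sublists⇒⊑ L S′∈

unique-⊑ : {A : Set} {S L : List A} → S ⊑ L → Unique L → Unique S
unique-⊑ []         []      = []
unique-⊑ (y ∷ʳ s)   (_ ∷ u) = unique-⊑ s u
unique-⊑ (refl ∷ s) (a ∷ u) = All-resp-⊆ s a ∷ unique-⊑ s u

length-filter-≢ : {A : Set} (_≟_ : DecidableEquality A) (v : A) {S : List A} → Unique S →
  length S ≤ suc (length (filter (λ x → ¬? (x ≟ v)) S))
length-filter-≢ _≟_ v []      = z≤n
length-filter-≢ _≟_ v {x ∷ S} (x∉ ∷ u) with x ≟ v
... | no _     = s≤s (length-filter-≢ _≟_ v u)
... | yes refl = s≤s (≤-reflexive (sym (all-kept x∉)))
  where
  all-kept : ∀ {S} → All (x ≢_) S → length (filter (λ y → ¬? (y ≟ x)) S) ≡ length S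
  all-kept []       = refl
  all-kept {y ∷ S} (x≢ ∷ a) with y ≟ x
  ... | yes refl = ⊥-elim (x≢ refl)
  ... | no _     = cong suc (all-kept a)

independent-⊆ : {A : Set} {G : Multigraph A} {S S′ : List A} → S ⊆ S′ → Independent G S′ → Independent G S
independent-⊆ s = All.map λ ¬both (u∈ , v∈) → ¬both (s u∈ , s v∈)

W-complete : ∀ n (h : Point n) → h ∈ W n
W-complete n (v , k) = ∈-cartesianProduct⁺ (∈-allFin v) (∈-allFin k)

W-unique : ∀ n → Unique (W n)
W-unique n = Unique.cartesianProduct⁺ (Unique.allFin⁺ n) (Unique.allFin⁺ 3)

module Independence {n : ℕ} where

  open DecMembership (Fin._≟_ {n}) using (_∈?_)

  α-max : ∀ G {S} → S ⊑ V n → Independent G S → length S ≤ α G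
  α-max G s ind = All.lookup (xs≤max 0 _)
    (∈-map⁺ length (∈-filter⁺ (independent? G) (⊑⇒∈sublists s) ind))

  independent-[] : ∀ (G : Multigraph (Fin n)) → Independent G []
  independent-[] []      = []
  independent-[] (_ ∷ G) = (λ ()) ∷ independent-[] G

  α-attained : ∀ G → ∃[ S ] (S ⊑ V n × Independent G S × length S ≡ α G)
  α-attained G with argmax-sel id 0 (map length (filter (independent? G) (sublists (V n))))
  ... | inj₁ α≡0 = [] , minimum (V n) , independent-[] G , sym α≡0
  ... | inj₂ α∈ with ∈-map⁻ length α∈
  ...   | S , S∈ , α≡ with ∈-filter⁻ (independent? G) {xs = sublists (V n)} S∈
  ...     | S∈′ , ind = S , ∈sublists⇒⊑ (V n) S∈′ , ind , sym α≡

  α-mono : ∀ {G G′} → (∀ S → Independent G S → Independent G′ S) → α G ≤ α G′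
  α-mono {G} {G′} imp with α-attained G
  ... | S , s , ind , eq = subst (_≤ α G′) eq (α-max G′ s (imp S ind))

  -- A maximum independent set stays independent under a loop at `v` once `v` is removed from it.
  α-loop : ∀ G v → α G ≤ suc (α ((v , v) ∷ G))
  α-loop G v with α-attained G
  ... | S , s , ind , eq = subst (_≤ _) eq (≤-trans
    (length-filter-≢ Fin._≟_ v (unique-⊑ s (Unique.allFin⁺ n)))
    (s≤s (α-max ((v , v) ∷ G) (⊆-trans (filter-⊆ keep? S) s)
      ((λ (v∈ , _) → proj₂ (∈-filter⁻ keep? {xs = S} v∈) refl) ∷
       independent-⊆ (lookup (filter-⊆ keep? S)) ind))))
    where
    keep? : Decidable (_≢ v)
    keep? x = ¬? (x Fin.≟ v)

  -- A vertex is frozen if it belongs to every maximum independent set.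
  Frozen : Multigraph (Fin n) → Fin n → Set
  Frozen G v = α ((v , v) ∷ G) < α G

  frozen? : ∀ G → Decidable (Frozen G)
  frozen? G v = α ((v , v) ∷ G) ℕ.<? α G

  -- An independent set of the enlarged graph misses `v` or `w`, so it is independent for a loop at
  -- that end, and a loop at a frozen vertex lowers `α`.
  α-edge : ∀ G {v w} → Frozen G v → Frozen G w → α ((v , w) ∷ G) < α G
  α-edge G {v} {w} fv fw with α-attained ((v , w) ∷ G)
  ... | S , s , (¬both ∷ ind) , eq with v ∈? S
  ...   | no v∉  = subst (_< α G) eq (≤-<-trans (α-max _ s ((v∉ ∘ proj₁) ∷ ind)) fv)
  ...   | yes v∈ = subst (_< α G) eq (≤-<-trans (α-max _ s ((λ (w∈ , _) → ¬both (v∈ , w∈)) ∷ ind)) fw)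

  weight : Multigraph (Fin n) → ℕ
  weight G = 16 ^ α G

  -- Two frozen ends lower the exponent, so at least 15/16 of the weight is lost; in all other cases
  -- monotonicity suffices.
  weight-edge : ∀ G v w → 16 * weight ((v , w) ∷ G) + 15 * weight G * (⟦ frozen? G v ⟧ * ⟦ frozen? G w ⟧) ≤ 16 * weight G
  weight-edge G v w = by-cases (frozen? G v) (frozen? G w)
    where
    open ≤-Reasoning
    absent : ∀ z → z ≡ 0 → 16 * weight ((v , w) ∷ G) + 15 * weight G * z ≤ 16 * weight G
    absent .0 refl = ≤-trans (≤-reflexive (trans (cong (16 * weight ((v , w) ∷ G) +_) (*-zeroʳ (15 * weight G))) (+-identityʳ _)))
      (*-monoʳ-≤ 16 (^-monoʳ-≤ 16 (α-mono λ S → λ { (_ ∷ ind) → ind })))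
    by-cases : (f : Dec (Frozen G v)) (f′ : Dec (Frozen G w)) →
      16 * weight ((v , w) ∷ G) + 15 * weight G * (⟦ f ⟧ * ⟦ f′ ⟧) ≤ 16 * weight G
    by-cases (no _)   _        = absent 0 refl
    by-cases (yes _)  (no _)   = absent 0 refl
    by-cases (yes fv) (yes fw) = begin
      16 * weight ((v , w) ∷ G) + 15 * weight G * 1  ≤⟨ +-monoˡ-≤ _ (^-monoʳ-≤ 16 (α-edge G fv fw)) ⟩
      weight G + 15 * weight G * 1                   ≡⟨ lemma (weight G) ⟩
      16 * weight G                                  ∎
      where
      lemma : ∀ x → x + 15 * x * 1 ≡ 16 * x
      lemma = solve-∀

  -- Here the loss is bounded from above: a loop at a frozen vertex costs at most 15/16 of the
  -- weight, any other loop nothing. With one outcome without a loop and two with one, 48 = 3 · 16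
  -- and 30 = 2 · 15.
  weight-loop : ∀ G v → 48 * weight G ≤
    16 * (weight G + 2 * weight ((v , v) ∷ G)) + 30 * weight G * ⟦ frozen? G v ⟧
  weight-loop G v = by-cases (frozen? G v)
    where
    open ≤-Reasoning
    by-cases : (f : Dec (Frozen G v)) →
      48 * weight G ≤ 16 * (weight G + 2 * weight ((v , v) ∷ G)) + 30 * weight G * ⟦ f ⟧
    by-cases (yes _) = begin
      48 * weight G                                                      ≡⟨ l₁ (weight G) ⟩
      2 * weight G + 46 * weight G                                       ≤⟨ +-monoˡ-≤ _ (*-monoʳ-≤ 2 (^-monoʳ-≤ 16 (α-loop G v))) ⟩
      2 * (16 * weight ((v , v) ∷ G)) + 46 * weight G                    ≡⟨ l₂ (weight G) (weight ((v , v) ∷ G)) ⟩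
      16 * (weight G + 2 * weight ((v , v) ∷ G)) + 30 * weight G * 1     ∎
      where
      l₁ : ∀ x → 48 * x ≡ 2 * x + 46 * x
      l₁ = solve-∀
      l₂ : ∀ x y → 2 * (16 * y) + 46 * x ≡ 16 * (x + 2 * y) + 30 * x * 1
      l₂ = solve-∀
    by-cases (no ¬f) = begin
      48 * weight G                                                      ≡⟨ l₁ (weight G) ⟩
      16 * (weight G + 2 * weight G)                                     ≤⟨ *-monoʳ-≤ 16 (+-monoʳ-≤ (weight G) (*-monoʳ-≤ 2 (^-monoʳ-≤ 16 (≮⇒≥ ¬f)))) ⟩
      16 * (weight G + 2 * weight ((v , v) ∷ G))                         ≤⟨ m≤m+n _ _ ⟩
      16 * (weight G + 2 * weight ((v , v) ∷ G)) + 30 * weight G * 0     ∎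
      where
      l₁ : ∀ x → 48 * x ≡ 16 * (x + 2 * x)
      l₁ = solve-∀

-- Here c counts the free points over frozen vertices, among suc x free points.
-- For the fraction c′ = c / suc x the inequality behind this is
-- 1 − (15/16) c′² + 7/12 ≤ 2 (1 − (15/16) (2/3) c′), that is (c′ − 2/3)² ≥ 0;
-- lowering 7/12 to 699/1200 pays for sampling without replacement.
interpolation-arithmetic : ∀ X mX kX c x D →
  16 * mX + 15 * X * D ≤ 16 * X * (x * suc x) →
  D + c ≡ c * c →
  48 * X * suc x ≤ 16 * kX + 30 * X * c →
  299 ≤ x →
  1200 * mX + 699 * (X * (x * suc x)) ≤ 800 * (x * kX)
interpolation-arithmetic X mX kX c x D edge D+c loop 299≤x =
  +-cancelʳ-≤ T _ _ (begin
    1200 * mX + 699 * q + T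
      ≡⟨ l₁ mX (X * D) q r ⟩
    75 * (16 * mX + 15 * (X * D)) + 50 * (48 * q) + 3 * (500 * r) + 699 * q
      ≤⟨ +-monoˡ-≤ (699 * q) (+-mono-≤ (+-mono-≤ (*-monoʳ-≤ 75 edge′) (*-monoʳ-≤ 50 loop′)) (*-monoʳ-≤ 3 quad)) ⟩
    75 * (16 * q) + 50 * (16 * (x * kX) + 30 * r) + 3 * (167 * q + 375 * (X * D)) + 699 * q
      ≡⟨ l₂ (X * D) q r (x * kX) ⟩
    800 * (x * kX) + T ∎)
  where
  open ≤-Reasoning
  q r T : ℕ
  q = X * (x * suc x)
  r = X * (c * x)
  -- The multipliers 75, 50 and 3 of the three inequalities cancel `X * D` (75 · 15 = 3 · 375) and
  -- `r` (50 · 30 = 3 · 500). What remains of `q` is 1200 - 3 · 167 = 699.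
  T = 1125 * (X * D) + 2400 * q + 1500 * r
  l₁ : ∀ m p q r → 1200 * m + 699 * q + (1125 * p + 2400 * q + 1500 * r) ≡
    75 * (16 * m + 15 * p) + 50 * (48 * q) + 3 * (500 * r) + 699 * q
  l₁ = solve-∀
  l₂ : ∀ p q r k → 75 * (16 * q) + 50 * (16 * k + 30 * r) + 3 * (167 * q + 375 * p) + 699 * q ≡
    800 * k + (1125 * p + 2400 * q + 1500 * r)
  l₂ = solve-∀
  edge′ : 16 * mX + 15 * (X * D) ≤ 16 * q
  edge′ = subst₂ _≤_ (cong (16 * mX +_) (*-assoc 15 X D)) (*-assoc 16 X (x * suc x)) edge
  loop′ : 48 * q ≤ 16 * (x * kX) + 30 * r
  loop′ = subst₂ _≤_ (l₃ X x) (l₄ X x kX c) (*-monoʳ-≤ x loop)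
    where
    l₃ : ∀ X x → x * (48 * X * suc x) ≡ 48 * (X * (x * suc x))
    l₃ = solve-∀
    l₄ : ∀ X x k c → x * (16 * k + 30 * X * c) ≡ 16 * (x * k) + 30 * (X * (c * x))
    l₄ = solve-∀
  quad : 500 * r ≤ 167 * q + 375 * (X * D)
  quad = +-cancelʳ-≤ (375 * (X * c)) _ _ (begin
    500 * r + 375 * (X * c)
      ≡⟨ l₅ X c x ⟩
    X * (500 * (c * x) + 375 * c)
      ≤⟨ *-monoʳ-≤ X (quadratic c x 299≤x) ⟩
    X * (167 * (x * suc x) + 375 * (c * c))
      ≡⟨ cong (λ y → X * (167 * (x * suc x) + 375 * y)) (sym D+c) ⟩
    X * (167 * (x * suc x) + 375 * (D + c))
      ≡⟨ l₆ X (x * suc x) D c ⟩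
    167 * q + 375 * (X * D) + 375 * (X * c) ∎)
    where
    l₅ : ∀ X c x → 500 * (X * (c * x)) + 375 * (X * c) ≡ X * (500 * (c * x) + 375 * c)
    l₅ = solve-∀
    l₆ : ∀ X y D c → X * (167 * y + 375 * (D + c)) ≡ 167 * (X * y) + 375 * (X * D) + 375 * (X * c)
    l₆ = solve-∀

-- Expansions over subsets

-- (15 + 27)^|L|, expanded over the subsets of L
∑-sublists : {A : Set} (_∈?_ : ∀ v (S : List A) → Dec (v ∈ S)) {L : List A} → Unique L →
  ∑ (sublists L) (λ S → 15 ^ length S * 27 ^ ∑ L (λ v → 1 ∸ ⟦ v ∈? S ⟧)) ≡ 42 ^ length L
∑-sublists _∈?_ [] = refl
∑-sublists {A} _∈?_ {x ∷ L} (x∉ ∷ u) = begin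
  ∑ (map (x ∷_) (sublists L) ++ sublists L) (term (x ∷ L))
    ≡⟨ ∑-++ (map (x ∷_) (sublists L)) (sublists L) _ ⟩
  ∑ (map (x ∷_) (sublists L)) (term (x ∷ L)) + ∑ (sublists L) (term (x ∷ L))
    ≡⟨ cong₂ _+_ (trans (∑-map (x ∷_) _ (sublists L)) (∑-cong-∈ (sublists L) with-x))
                 (∑-cong-∈ (sublists L) without-x) ⟩
  ∑ (sublists L) (λ S → 15 * term L S) + ∑ (sublists L) (λ S → 27 * term L S)
    ≡⟨ cong₂ _+_ (∑-*ˡ (sublists L) 15 _) (∑-*ˡ (sublists L) 27 _) ⟩
  15 * ∑ (sublists L) (term L) + 27 * ∑ (sublists L) (term L)
    ≡⟨ cong (λ z → 15 * z + 27 * z) (∑-sublists _∈?_ u) ⟩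
  15 * 42 ^ length L + 27 * 42 ^ length L
    ≡⟨ sym (*-distribʳ-+ (42 ^ length L) 15 27) ⟩
  42 * 42 ^ length L ∎
  where
  open ≡-Reasoning
  absent : List A → A → ℕ
  absent S v = 1 ∸ ⟦ v ∈? S ⟧
  term : List A → List A → ℕ
  term L S = 15 ^ length S * 27 ^ ∑ L (absent S)
  with-x : ∀ S → S ∈ sublists L → term (x ∷ L) (x ∷ S) ≡ 15 * term L S
  with-x S _ = begin
    15 * 15 ^ length S * 27 ^ (absent (x ∷ S) x + ∑ L (absent (x ∷ S)))
      ≡⟨ cong (λ e → 15 * 15 ^ length S * 27 ^ e)
           (cong₂ _+_ (cong (1 ∸_) (⟦⟧-true (x ∈? (x ∷ S)) (here refl)))
             (∑-cong-∈ L λ v v∈ → cong (1 ∸_) (⟦⟧-cong (v ∈? (x ∷ S)) (v ∈? S)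
               (λ { (here v≡x) → ⊥-elim (All.lookup x∉ v∈ (sym v≡x)) ; (there v∈S) → v∈S }) there))) ⟩
    15 * 15 ^ length S * 27 ^ ∑ L (absent S)
      ≡⟨ *-assoc 15 (15 ^ length S) _ ⟩
    15 * term L S ∎
  without-x : ∀ S → S ∈ sublists L → term (x ∷ L) S ≡ 27 * term L S
  without-x S S∈ = begin
    15 ^ length S * 27 ^ (absent S x + ∑ L (absent S))
      ≡⟨ cong (λ e → 15 ^ length S * 27 ^ (e + ∑ L (absent S)))
           (cong (1 ∸_) (⟦⟧-false (x ∈? S) λ x∈ → All.lookup x∉ (lookup (∈sublists⇒⊑ L S∈) x∈) refl)) ⟩
    15 ^ length S * (27 * 27 ^ ∑ L (absent S))
      ≡⟨ *-left-comm (15 ^ length S) 27 _ ⟩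
    27 * term L S ∎

-- The binomial expansion of (15 + 1) ^ |S|. It turns the weight of one maximum independent set into
-- a sum over its subsets, all of them independent.
∑-16^ : {A : Set} (S : List A) → ∑ (sublists S) (λ T → 15 ^ length T) ≡ 16 ^ length S
∑-16^ []      = refl
∑-16^ (x ∷ S) = begin
  ∑ (map (x ∷_) (sublists S) ++ sublists S) (λ T → 15 ^ length T)
    ≡⟨ ∑-++ (map (x ∷_) (sublists S)) (sublists S) _ ⟩
  ∑ (map (x ∷_) (sublists S)) (λ T → 15 ^ length T) + ∑ (sublists S) (λ T → 15 ^ length T)
    ≡⟨ cong₂ _+_ (trans (∑-map (x ∷_) _ (sublists S)) (trans (∑-*ˡ (sublists S) 15 _) (cong (15 *_) (∑-16^ S)))) (∑-16^ S) ⟩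
  15 * 16 ^ length S + 16 ^ length S
    ≡⟨ +-comm (15 * 16 ^ length S) _ ⟩
  16 * 16 ^ length S ∎
  where open ≡-Reasoning

∑-sublists-⊑ : {A : Set} {S L : List A} (f : List A → ℕ) → S ⊑ L → ∑ (sublists S) f ≤ ∑ (sublists L) f
∑-sublists-⊑ f [] = ≤-refl
∑-sublists-⊑ {S = S} {y ∷ L} f (y ∷ʳ s) = ≤-trans (∑-sublists-⊑ f s)
  (≤-trans (m≤n+m _ _) (≤-reflexive (sym (∑-++ (map (y ∷_) (sublists L)) _ f))))
∑-sublists-⊑ {S = x ∷ S} {x ∷ L} f (refl ∷ s) = begin
  ∑ (map (x ∷_) (sublists S) ++ sublists S) f
    ≡⟨ ∑-++ (map (x ∷_) (sublists S)) _ f ⟩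
  ∑ (map (x ∷_) (sublists S)) f + ∑ (sublists S) f
    ≡⟨ cong (_+ _) (∑-map (x ∷_) f (sublists S)) ⟩
  ∑ (sublists S) (f ∘ (x ∷_)) + ∑ (sublists S) f
    ≤⟨ +-mono-≤ (∑-sublists-⊑ (f ∘ (x ∷_)) s) (∑-sublists-⊑ f s) ⟩
  ∑ (sublists L) (f ∘ (x ∷_)) + ∑ (sublists L) f
    ≡⟨ cong (_+ _) (sym (∑-map (x ∷_) f (sublists L))) ⟩
  ∑ (map (x ∷_) (sublists L)) f + ∑ (sublists L) f
    ≡⟨ sym (∑-++ (map (x ∷_) (sublists L)) _ f) ⟩
  ∑ (map (x ∷_) (sublists L) ++ sublists L) f ∎
  where open ≤-Reasoning

∑-W : ∀ n (f : Fin n → ℕ) → ∑ (W n) (f ∘ proj₁) ≡ 3 * ∑ (V n) f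
∑-W n f = over (V n)
  where
  triple : ∀ x y → x + (x + (x + 0)) + 3 * y ≡ 3 * (x + y)
  triple = solve-∀
  over : ∀ L → ∑ (cartesianProduct L (allFin 3)) (f ∘ proj₁) ≡ 3 * ∑ L f
  over []      = refl
  over (v ∷ L) = begin
    ∑ (map (v ,_) (allFin 3) ++ cartesianProduct L (allFin 3)) (f ∘ proj₁)
      ≡⟨ ∑-++ (map (v ,_) (allFin 3)) (cartesianProduct L (allFin 3)) (f ∘ proj₁) ⟩
    (f v + (f v + (f v + 0))) + ∑ (cartesianProduct L (allFin 3)) (f ∘ proj₁)
      ≡⟨ cong (f v + (f v + (f v + 0)) +_) (over L) ⟩
    (f v + (f v + (f v + 0))) + 3 * ∑ L f
      ≡⟨ triple (f v) (∑ L f) ⟩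
    3 * ∑ (v ∷ L) f ∎
    where open ≡-Reasoning

-- The weight under matches and kills

module Configuration (n : ℕ) where

  open Exploration (_≟ᵖ_ {n}) (W n) (W-complete n) (W-unique n) public
  open Independence {n} public
  open DecMembership (Fin._≟_ {n}) using (_∈?_)

  #free-[] : #free [] ≡ 3 * n
  #free-[] = begin
    ∑ (W n) (λ _ → 1)  ≡⟨ ∑-W n (λ _ → 1) ⟩
    3 * ∑ (V n) (λ _ → 1)    ≡⟨ cong (3 *_) (trans (∑-1 (V n)) (length-tabulate {n = n} id)) ⟩
    3 * n                    ∎
    where open ≡-Reasoning

  -- The factorial turns the sums in match and kill into averages, up to the
  -- constant factor (3 n)! and a factor 3 for every kill.
  Value : Functional
  Value u G = weight (π G) * #free u !

  Value-symmetric : Symmetric Value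
  Value-symmetric u≋ (G⊆ , G⊇) = cong₂ (λ a m → 16 ^ a * m !)
    (≤-antisym (α-mono (transfer G⊇)) (α-mono (transfer G⊆))) (∑∉-≋ u≋ _)
    where
    transfer : ∀ {G G′ : Multigraph (Point n)} → G′ ⊆ G → ∀ S → Independent (π G) S → Independent (π G′) S
    transfer G′⊆ S ind = All.tabulate λ e∈ → All.lookup ind (Subset.map⁺ _ G′⊆ e∈)

  match-Value : ∀ u G → match Value u G ≤ Value u G
  match-Value u G = begin
    ∑∉ u (λ h → ∑∉ (h ∷ u) λ h′ → weight (π ((h , h′) ∷ G)) * #free (h′ ∷ h ∷ u) !)
      ≤⟨ ∑∉-mono u (λ h _ → ∑∉-mono (h ∷ u) λ h′ _ →
           *-monoˡ-≤ (#free (h′ ∷ h ∷ u) !) (^-monoʳ-≤ 16 (α-mono {(proj₁ h , proj₁ h′) ∷ π G} λ { S (_ ∷ ind) → ind }))) ⟩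
    ∑∉ u (λ h → ∑∉ (h ∷ u) λ h′ → weight (π G) * #free (h′ ∷ h ∷ u) !)
      ≡⟨ ∑∉-cong u (λ h _ → ∑∉-*ˡ (h ∷ u) (weight (π G)) _) ⟩
    ∑∉ u (λ h → weight (π G) * ∑∉ (h ∷ u) λ h′ → #free (h′ ∷ h ∷ u) !)
      ≡⟨ ∑∉-*ˡ u (weight (π G)) _ ⟩
    weight (π G) * ∑∉ u (λ h → ∑∉ (h ∷ u) λ h′ → #free (h′ ∷ h ∷ u) !)
      ≤⟨ *-monoʳ-≤ (weight (π G)) (≤-trans (∑∉-mono u λ h _ → ∑∉-factorial (h ∷ u)) (∑∉-factorial u)) ⟩
    weight (π G) * #free u ! ∎
    where open ≤-Reasoning

  matches-mono : ∀ k {Y Y′} → (∀ u G → Y u G ≤ Y′ u G) → ∀ u G → iterate k match Y u G ≤ iterate k match Y′ u G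
  matches-mono zero    le = le
  matches-mono (suc k) le = matches-mono k (match-mono le)

  -- The innermost matches act last, when too few points may be free for `Value-bound`. They can be
  -- discarded because an edge never raises the weight.
  matches-Value : ∀ s k u G → iterate (s + k) match Value u G ≤ iterate k match Value u G
  matches-Value zero    k u G = ≤-refl
  matches-Value (suc s) k u G = ≤-trans (matches-mono (s + k) match-Value u G) (matches-Value s k u G)

  Value-bound : Bound 300 1200 699 800 (match Value) Value (kill Value)
  Value-bound u G 300≤ = from-#free (#free u) refl 300≤
    where
    open ≤-Reasoning
    X : ℕ
    X = weight (π G)
    κ : Point n → ℕ
    κ h = ⟦ frozen? (π G) (proj₁ h) ⟧
    mX kX c D : ℕ
    mX = ∑∉ u λ h → ∑∉ (h ∷ u) λ h′ → weight (π ((h , h′) ∷ G))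
    kX = ∑∉ u λ h → weight (π G) + 2 * weight (π ((h , h) ∷ G))
    c = ∑∉ u κ
    D = ∑∉ u λ h → ∑∉ (h ∷ u) λ h′ → κ h * κ h′

    -- Drawing without replacement, `D` lacks the diagonal of `c * c`; as `κ` takes only the values
    -- 0 and 1, the diagonal adds up to `c`.
    D+c : D + c ≡ c * c
    D+c = begin-equality
      D + c
        ≡⟨ sym (∑∉-+ u _ κ) ⟩
      ∑∉ u (λ h → ∑∉ (h ∷ u) (λ h′ → κ h * κ h′) + κ h)
        ≡⟨ ∑∉-cong u (λ h h∉ → square h h∉) ⟩
      ∑∉ u (λ h → c * κ h)
        ≡⟨ ∑∉-*ˡ u c κ ⟩
      c * c ∎
      where
      square : ∀ h → h ∉ u → ∑∉ (h ∷ u) (λ h′ → κ h * κ h′) + κ h ≡ c * κ h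
      square h h∉ = begin-equality
        ∑∉ (h ∷ u) (λ h′ → κ h * κ h′) + κ h
          ≡⟨ cong₂ _+_ (∑∉-*ˡ (h ∷ u) (κ h) κ) (sym (⟦⟧-idem (frozen? (π G) (proj₁ h)))) ⟩
        κ h * ∑∉ (h ∷ u) κ + κ h * κ h
          ≡⟨ sym (*-distribˡ-+ (κ h) _ _) ⟩
        κ h * (∑∉ (h ∷ u) κ + κ h)
          ≡⟨ cong (κ h *_) (∑∉-∷ κ h∉) ⟩
        κ h * c
          ≡⟨ *-comm (κ h) c ⟩
        c * κ h ∎

    loop : 48 * X * #free u ≤ 16 * kX + 30 * X * c
    loop = begin
      48 * X * #free u
        ≡⟨ sym (∑∉-const u (48 * X)) ⟩
      ∑∉ u (λ _ → 48 * X)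
        ≤⟨ ∑∉-mono u (λ h _ → weight-loop (π G) (proj₁ h)) ⟩
      ∑∉ u (λ h → 16 * (weight (π G) + 2 * weight (π ((h , h) ∷ G))) + 30 * X * κ h)
        ≡⟨ trans (∑∉-+ u _ _) (cong₂ _+_ (∑∉-*ˡ u 16 _) (∑∉-*ˡ u (30 * X) κ)) ⟩
      16 * kX + 30 * X * c ∎

    from-#free : ∀ m → #free u ≡ m → 300 ≤ m →
      1200 * match Value u G + 699 * Value u G ≤ 800 * kill Value u G
    from-#free (suc zero)    _  (s≤s ())
    -- `x` and `y` count the points left after one and after two draws, so `y !` can be factored out
    -- of all three terms.
    from-#free (suc (suc y)) eq (s≤s 299≤x) = begin
      1200 * match Value u G + 699 * Value u G
        ≡⟨ cong₂ (λ a b → 1200 * a + 699 * b) match≡ (cong (λ m → X * m !) {#free u} {suc (suc y)} eq) ⟩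
      1200 * (y ! * mX) + 699 * (X * (suc x * (x * y !)))
        ≡⟨ l₁ (y !) mX X x ⟩
      y ! * (1200 * mX + 699 * (X * (x * suc x)))
        ≤⟨ *-monoʳ-≤ (y !) (interpolation-arithmetic X mX kX c x D edge D+c
             (subst (λ m → 48 * X * m ≤ 16 * kX + 30 * X * c) eq loop) 299≤x) ⟩
      y ! * (800 * (x * kX))
        ≡⟨ l₂ (y !) x kX ⟩
      800 * (x * y ! * kX)
        ≡⟨ cong (800 *_) (sym kill≡) ⟩
      800 * kill Value u G ∎
      where
      x : ℕ
      x = suc y
      l₁ : ∀ F m X x → 1200 * (F * m) + 699 * (X * (suc x * (x * F))) ≡ F * (1200 * m + 699 * (X * (x * suc x)))
      l₁ = solve-∀
      l₂ : ∀ F x k → F * (800 * (x * k)) ≡ 800 * (x * F * k)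
      l₂ = solve-∀
      free₁ : ∀ {h} → h ∉ u → #free (h ∷ u) ≡ x
      free₁ h∉ = suc-injective (trans (#free-∷ h∉) eq)
      free₂ : ∀ {h h′} → h ∉ u → h′ ∉ (h ∷ u) → #free (h′ ∷ h ∷ u) ≡ y
      free₂ h∉ h′∉ = suc-injective (trans (#free-∷ h′∉) (free₁ h∉))
      match≡ : match Value u G ≡ y ! * mX
      match≡ = begin-equality
        match Value u G
          ≡⟨ ∑∉-cong u (λ h h∉ → trans
               (∑∉-cong (h ∷ u) λ h′ h′∉ → trans (cong (λ m → weight (π ((h , h′) ∷ G)) * m !) (free₂ h∉ h′∉)) (*-comm _ (y !)))
               (∑∉-*ˡ (h ∷ u) (y !) _)) ⟩
        ∑∉ u (λ h → y ! * ∑∉ (h ∷ u) λ h′ → weight (π ((h , h′) ∷ G)))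
          ≡⟨ ∑∉-*ˡ u (y !) _ ⟩
        y ! * mX ∎
      kill≡ : kill Value u G ≡ x ! * kX
      kill≡ = begin-equality
        kill Value u G
          ≡⟨ ∑∉-cong u (λ h h∉ → trans (cong (λ m → X * m ! + 2 * (weight (π ((h , h) ∷ G)) * m !)) (free₁ h∉))
                                          (l₃ X (weight (π ((h , h) ∷ G))) (x !))) ⟩
        ∑∉ u (λ h → x ! * (X + 2 * weight (π ((h , h) ∷ G))))
          ≡⟨ ∑∉-*ˡ u (x !) _ ⟩
        x ! * kX ∎
        where
        l₃ : ∀ a b F → a * F + 2 * (b * F) ≡ F * (a + 2 * b)
        l₃ = solve-∀
      edge : 16 * mX + 15 * X * D ≤ 16 * X * (x * suc x)
      edge = begin
        16 * mX + 15 * X * D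
          ≤⟨ ∑∉-combine u 16 (15 * X) (16 * X) (λ h h∉ → ∑∉-combine (h ∷ u) 16 (15 * X) (16 * X) λ h′ _ →
               ≤-trans (weight-edge (π G) (proj₁ h) (proj₁ h′)) (≤-reflexive (sym (*-identityʳ (16 * X))))) ⟩
        16 * X * ∑∉ u (λ h → ∑∉ (h ∷ u) λ _ → 1)
          ≡⟨ cong (16 * X *_) (trans (∑∉-cong u λ h h∉ → free₁ h∉) (trans (∑∉-const u x) (cong (x *_) eq))) ⟩
        16 * X * (x * suc x) ∎

  -- First moment bound for the exploration without match steps: weight is
  -- expanded as ∑ 15 ^ |S| over independent sets S, and each kill step
  -- preserves the S-term, since it succeeds with probability 1 outside S
  -- and 1/3 inside S.
  module _ (S : List (Fin n)) where

    outside : Point n → ℕ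
    outside h = 1 ∸ ⟦ proj₁ h ∈? S ⟧

    -- The power of 3 is a potential for future kills: at a point outside `S` all 1 + 2 outcomes
    -- keep `S` independent, at a point over `S` only the one without a loop.
    survival : Functional
    survival u G = ⟦ independent? (π G) S ⟧ * 3 ^ ∑∉ u outside

    kill-survival : ∀ u G h → h ∉ u →
      survival (h ∷ u) G + 2 * survival (h ∷ u) ((h , h) ∷ G) ≤ survival u G
    kill-survival u G h h∉ = by-cases (proj₁ h ∈? S) refl
      where
      open ≤-Reasoning
      ind : ℕ
      ind = ⟦ independent? (π G) S ⟧
      l₁ : ∀ i p → i * p + 2 * (i * p) ≡ i * (3 * p)
      l₁ = solve-∀
      by-cases : (d : Dec (proj₁ h ∈ S)) → outside h ≡ 1 ∸ ⟦ d ⟧ →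
        survival (h ∷ u) G + 2 * survival (h ∷ u) ((h , h) ∷ G) ≤ survival u G
      by-cases (yes h∈) eq = begin
        survival (h ∷ u) G + 2 * survival (h ∷ u) ((h , h) ∷ G)
          ≡⟨ cong (λ i → survival (h ∷ u) G + 2 * (i * 3 ^ ∑∉ (h ∷ u) outside))
               (⟦⟧-false (independent? (π ((h , h) ∷ G)) S) λ { (¬both ∷ _) → ¬both (h∈ , h∈) }) ⟩
        survival (h ∷ u) G + 0
          ≡⟨ +-identityʳ _ ⟩
        ind * 3 ^ ∑∉ (h ∷ u) outside
          ≡⟨ cong (λ e → ind * 3 ^ e) (trans (sym (+-identityʳ _)) (trans (cong (∑∉ (h ∷ u) outside +_) (sym eq)) (∑∉-∷ outside h∉))) ⟩
        survival u G ∎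
      by-cases (no _) eq = begin
        survival (h ∷ u) G + 2 * survival (h ∷ u) ((h , h) ∷ G)
          ≤⟨ +-monoʳ-≤ (survival (h ∷ u) G) (*-monoʳ-≤ 2 (*-monoˡ-≤ (3 ^ ∑∉ (h ∷ u) outside)
               (⟦⟧-mono (independent? (π ((h , h) ∷ G)) S) (independent? (π G) S) λ { (_ ∷ ind) → ind }))) ⟩
        survival (h ∷ u) G + 2 * survival (h ∷ u) G
          ≡⟨ l₁ ind (3 ^ ∑∉ (h ∷ u) outside) ⟩
        ind * 3 ^ suc (∑∉ (h ∷ u) outside)
          ≡⟨ cong (λ e → ind * 3 ^ e) (trans (+-comm 1 _) (trans (cong (∑∉ (h ∷ u) outside +_) (sym eq)) (∑∉-∷ outside h∉))) ⟩
        survival u G ∎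

  Moment : Functional
  Moment u G = ∑ (sublists (V n)) (λ S → 15 ^ length S * survival S u G) * #free u !

  kill-Moment : ∀ u G → kill Moment u G ≤ Moment u G
  kill-Moment u G = begin
    kill Moment u G
      ≡⟨ ∑∉-cong u (λ h _ → trans (l₁ (T (h ∷ u) G) (T (h ∷ u) ((h , h) ∷ G)) (#free (h ∷ u) !))
           (cong (_* #free (h ∷ u) !) (trans (cong (T (h ∷ u) G +_) (sym (∑-*ˡ (sublists (V n)) 2 _))) (sym (∑-+ (sublists (V n)) _ _))))) ⟩
    ∑∉ u (λ h → ∑ (sublists (V n)) (λ S → 15 ^ length S * survival S (h ∷ u) G + 2 * (15 ^ length S * survival S (h ∷ u) ((h , h) ∷ G))) * #free (h ∷ u) !)
      ≤⟨ ∑∉-mono u (λ h h∉ → *-monoˡ-≤ (#free (h ∷ u) !) (∑-mono (sublists (V n)) λ S _ →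
           ≤-trans (≤-reflexive (l₂ (15 ^ length S) (survival S (h ∷ u) G) (survival S (h ∷ u) ((h , h) ∷ G)))) (*-monoʳ-≤ (15 ^ length S) (kill-survival S u G h h∉)))) ⟩
    ∑∉ u (λ h → T u G * #free (h ∷ u) !)
      ≡⟨ ∑∉-*ˡ u (T u G) _ ⟩
    T u G * ∑∉ u (λ h → #free (h ∷ u) !)
      ≤⟨ *-monoʳ-≤ (T u G) (∑∉-factorial u) ⟩
    Moment u G ∎
    where
    open ≤-Reasoning
    T : List (Point n) → List (Point n × Point n) → ℕ
    T u G = ∑ (sublists (V n)) (λ S → 15 ^ length S * survival S u G)
    l₁ : ∀ a b F → a * F + 2 * (b * F) ≡ (a + 2 * b) * F
    l₁ = solve-∀
    l₂ : ∀ e a b → e * a + 2 * (e * b) ≡ e * (a + 2 * b)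
    l₂ = solve-∀

  -- The subsets of a single maximum independent set already contribute 16 ^ α to the moment, and
  -- every other set contributes a nonnegative amount.
  Value≤Moment : ∀ u G → Value u G ≤ Moment u G
  Value≤Moment u G with α-attained (π G)
  ... | S₀ , s , ind , eq = *-monoˡ-≤ (#free u !) (begin
    16 ^ α (π G)
      ≡⟨ cong (16 ^_) (sym eq) ⟩
    16 ^ length S₀
      ≡⟨ sym (∑-16^ S₀) ⟩
    ∑ (sublists S₀) (λ S → 15 ^ length S)
      ≤⟨ ∑-mono (sublists S₀) (λ S S∈ → counted S (∈sublists⇒⊑ S₀ S∈)) ⟩
    ∑ (sublists S₀) (λ S → 15 ^ length S * survival S u G)
      ≤⟨ ∑-sublists-⊑ _ s ⟩
    ∑ (sublists (V n)) (λ S → 15 ^ length S * survival S u G) ∎)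
    where
    open ≤-Reasoning
    counted : ∀ S → S ⊑ S₀ → 15 ^ length S ≤ 15 ^ length S * survival S u G
    counted S s = ≤-trans (≤-reflexive (sym (*-identityʳ _))) (*-monoʳ-≤ (15 ^ length S)
      (*-mono-≤ (≤-reflexive (sym (⟦⟧-true (independent? (π G) S) (independent-⊆ (lookup s) ind)))) (m^n>0 3 (∑∉ u (outside S)))))

  kills-Value : ∀ f → iterate f kill Value [] [] ≤ (3 * n) ! * 42 ^ n
  kills-Value f = begin
    iterate f kill Value [] []
      ≤⟨ kills-mono f Value≤Moment [] [] ⟩
    iterate f kill Moment [] []
      ≤⟨ kills-Moment f [] [] ⟩
    ∑ (sublists (V n)) (λ S → 15 ^ length S * survival S [] []) * #free [] !
      ≡⟨ cong₂ (λ t m → t * m !) (∑-cong (sublists (V n)) (λ S → cong (15 ^ length S *_) (initial S))) #free-[] ⟩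
    ∑ (sublists (V n)) (λ S → 15 ^ length S * 27 ^ ∑ (V n) (λ v → 1 ∸ ⟦ v ∈? S ⟧)) * (3 * n) !
      ≡⟨ cong (_* (3 * n) !) (∑-sublists _∈?_ (Unique.allFin⁺ n)) ⟩
    42 ^ length (V n) * (3 * n) !
      ≡⟨ cong (λ l → 42 ^ l * (3 * n) !) (length-tabulate {n = n} id) ⟩
    42 ^ n * (3 * n) !
      ≡⟨ *-comm (42 ^ n) _ ⟩
    (3 * n) ! * 42 ^ n ∎
    where
    open ≤-Reasoning
    kills-mono : ∀ f {Y Y′} → (∀ u G → Y u G ≤ Y′ u G) → ∀ u G → iterate f kill Y u G ≤ iterate f kill Y′ u G
    kills-mono zero    le = le
    kills-mono (suc f) le = kills-mono f (kill-mono le)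
    kills-Moment : ∀ f u G → iterate f kill Moment u G ≤ Moment u G
    kills-Moment zero    u G = ≤-refl
    kills-Moment (suc f) u G = ≤-trans (kills-mono f kill-Moment u G) (kills-Moment f u G)
    -- At the start each vertex outside `S` has three free points, hence 3³ = 27.
    initial : ∀ S → survival S [] [] ≡ 27 ^ ∑ (V n) (λ v → 1 ∸ ⟦ v ∈? S ⟧)
    initial S = begin-equality
      1 * 3 ^ ∑ (W n) (λ h → 1 * outside S h)
        ≡⟨ trans (*-identityˡ _) (cong (3 ^_) (trans (∑-cong (W n) λ h → *-identityˡ (outside S h)) (∑-W n (λ v → 1 ∸ ⟦ v ∈? S ⟧)))) ⟩
      3 ^ (3 * ∑ (V n) (λ v → 1 ∸ ⟦ v ∈? S ⟧))
        ≡⟨ sym (^-*-assoc 3 3 (∑ (V n) (λ v → 1 ∸ ⟦ v ∈? S ⟧))) ⟩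
      27 ^ ∑ (V n) (λ v → 1 ∸ ⟦ v ∈? S ⟧) ∎

-- Pairings as lists of two-element subsets

twoSubsets-∈ : {A : Set} {x y : A} (L : List A) → (x , y) ∈ twoSubsets L → x ∈ L × y ∈ L
twoSubsets-∈ (z ∷ L) e∈ with ∈-++⁻ (map (z ,_) L) e∈
... | inj₂ q = there (proj₁ (twoSubsets-∈ L q)) , there (proj₂ (twoSubsets-∈ L q))
... | inj₁ p with ∈-map⁻ (z ,_) p
...   | y , y∈ , refl = here refl , there y∈

twoSubsets-oriented : {A : Set} {x y : A} {L : List A} → Unique L →
  (x , y) ∈ twoSubsets L → ¬ (y , x) ∈ twoSubsets L
twoSubsets-oriented {x = x} {y} {z ∷ L} (z∉ ∷ u) e∈ e∈′
  with ∈-++⁻ (map (z ,_) L) e∈ | ∈-++⁻ (map (z ,_) L) e∈′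
... | inj₂ q | inj₂ q′ = twoSubsets-oriented u q q′
... | inj₁ p | inj₂ q′ with ∈-map⁻ (z ,_) p
...   | _ , _ , refl = All.lookup z∉ (proj₂ (twoSubsets-∈ L q′)) refl
twoSubsets-oriented {x = x} {y} {z ∷ L} (z∉ ∷ u) e∈ e∈′ | inj₂ q | inj₁ p′ with ∈-map⁻ (z ,_) p′
...   | _ , _ , refl = All.lookup z∉ (proj₂ (twoSubsets-∈ L q)) refl
twoSubsets-oriented {x = x} {y} {z ∷ L} (z∉ ∷ u) e∈ e∈′ | inj₁ p | inj₁ p′ with ∈-map⁻ (z ,_) p | ∈-map⁻ (z ,_) p′
...   | _ , y∈ , refl | _ , _ , refl = All.lookup z∉ y∈ refl

twoSubsets-unique : {A : Set} {L : List A} → Unique L → Unique (twoSubsets L)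
twoSubsets-unique []       = []
twoSubsets-unique {L = z ∷ L} (z∉ ∷ u) =
  Unique.++⁺ (Unique.map⁺ ,-injectiveʳ u) (twoSubsets-unique u) λ (p , q) → disjoint p q
  where
  disjoint : ∀ {e} → e ∈ map (z ,_) L → ¬ e ∈ twoSubsets L
  disjoint p q with ∈-map⁻ (z ,_) p
  ... | _ , _ , refl = All.lookup z∉ (proj₁ (twoSubsets-∈ L q)) refl

Agrees : {A : Set} → (A → Set) → List A → List A → Set
Agrees Q L F = All (λ e → (e ∈ F → Q e) × (Q e → e ∈ F)) L

agrees? : {A : Set} (_≟_ : DecidableEquality A) {Q : A → Set} → Decidable Q → ∀ L → Decidable (Agrees Q L)
agrees? _≟_ Q? L F = All.all? (λ e → ((e ∈? F) →-dec Q? e) ×-dec (Q? e →-dec (e ∈? F))) L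
  where open DecMembership _≟_ using (_∈?_)

-- In a list without repetitions `Q` dictates whether each entry is kept, so at every head at most
-- one of the two alternatives can agree.
sublist-determined : {A : Set} (_≟_ : DecidableEquality A) {Q : A → Set} (Q? : Decidable Q) {L : List A} → Unique L →
  ∑ (sublists L) (λ F → ⟦ agrees? _≟_ Q? L F ⟧) ≤ 1
sublist-determined _≟_ Q? [] = ≤-refl
sublist-determined {A} _≟_ {Q} Q? {x ∷ L} (x∉ ∷ u) = begin
  ∑ (map (x ∷_) (sublists L) ++ sublists L) agree
    ≡⟨ ∑-++ (map (x ∷_) (sublists L)) (sublists L) agree ⟩
  ∑ (map (x ∷_) (sublists L)) agree + ∑ (sublists L) agree
    ≡⟨ cong (_+ ∑ (sublists L) agree) (∑-map (x ∷_) agree (sublists L)) ⟩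
  ∑ (sublists L) (agree ∘ (x ∷_)) + ∑ (sublists L) agree
    ≤⟨ split (Q? x) ⟩
  ∑ (sublists L) agree′
    ≤⟨ sublist-determined _≟_ Q? u ⟩
  1 ∎
  where
  open ≤-Reasoning
  agree agree′ : List A → ℕ
  agree F = ⟦ agrees? _≟_ Q? (x ∷ L) F ⟧
  agree′ F = ⟦ agrees? _≟_ Q? L F ⟧
  drop-x : ∀ {F} → Agrees Q (x ∷ L) (x ∷ F) → Agrees Q L F
  drop-x (_ ∷ a) = All.tabulate λ {e} e∈ →
    proj₁ (All.lookup a e∈) ∘ there ,
    λ q → case proj₂ (All.lookup a e∈) q of λ where
      (here e≡x) → ⊥-elim (All.lookup x∉ e∈ (sym e≡x))
      (there e∈F) → e∈F
  split : Dec (Q x) → ∑ (sublists L) (agree ∘ (x ∷_)) + ∑ (sublists L) agree ≤ ∑ (sublists L) agree′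
  split (yes q) = begin
    ∑ (sublists L) (agree ∘ (x ∷_)) + ∑ (sublists L) agree
      ≤⟨ +-mono-≤
          (∑-mono (sublists L) λ F _ → ⟦⟧-mono (agrees? _≟_ Q? (x ∷ L) (x ∷ F)) (agrees? _≟_ Q? L F) drop-x)
          (≤-reflexive (trans (∑-cong-∈ (sublists L) λ F F∈ → ⟦⟧-false (agrees? _≟_ Q? (x ∷ L) F)
            λ { ((_ , x∈F) ∷ _) → All.lookup x∉ (lookup (∈sublists⇒⊑ L F∈) (x∈F q)) refl }) (∑-0 (sublists L)))) ⟩
    ∑ (sublists L) agree′ + 0
      ≡⟨ +-identityʳ _ ⟩
    ∑ (sublists L) agree′ ∎
  split (no ¬q) = +-mono-≤
    (≤-reflexive (trans (∑-cong (sublists L) λ F → ⟦⟧-false (agrees? _≟_ Q? (x ∷ L) (x ∷ F))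
            λ { ((x∈ , _) ∷ _) → ¬q (x∈ (here refl)) }) (∑-0 (sublists L))))
    (∑-mono (sublists L) λ F _ → ⟦⟧-mono (agrees? _≟_ Q? (x ∷ L) F) (agrees? _≟_ Q? L F) λ { (_ ∷ a) → a })

∑-filter-mono : {A : Set} {P : A → Set} (P? : Decidable P) (xs : List A) {f g : A → ℕ} →
  (∀ x → x ∈ xs → P x → f x ≤ g x) → ∑ (filter P? xs) f ≤ ∑ xs g
∑-filter-mono P? []       le = z≤n
∑-filter-mono P? (x ∷ xs) le with P? x
... | yes p = +-mono-≤ (le x (here refl) p) (∑-filter-mono P? xs λ y → le y ∘ there)
... | no _  = ≤-trans (∑-filter-mono P? xs λ y → le y ∘ there) (m≤n+m _ _)

module _ {A : Set} (_≟_ : DecidableEquality A) where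

  degree-∷ : ∀ x y F v → degree _≟_ ((x , y) ∷ F) v ≡ ⟦ v ≟ x ⟧ + (⟦ v ≟ y ⟧ + degree _≟_ F v)
  degree-∷ x y F v = trans (count x _) (cong (⟦ v ≟ x ⟧ +_) (count y _))
    where
    count : ∀ z zs → length (filter (v ≟_) (z ∷ zs)) ≡ ⟦ v ≟ z ⟧ + length (filter (v ≟_) zs)
    count z zs with v ≟ z
    ... | yes _ = refl
    ... | no _  = refl

  Incident : A → A × A → Set
  Incident v (x , y) = v ≡ x ⊎ v ≡ y

  incident-≤ : ∀ {v x y} k → Incident v (x , y) → suc k ≤ ⟦ v ≟ x ⟧ + (⟦ v ≟ y ⟧ + k)
  incident-≤ {v} {x} {y} k (inj₁ v≡x) rewrite ⟦⟧-true (v ≟ x) v≡x = s≤s (m≤n+m k _)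
  incident-≤ {v} {x} {y} k (inj₂ v≡y) rewrite ⟦⟧-true (v ≟ y) v≡y = m≤n+m (suc k) _

  incident⇒degree : ∀ {F v e} → e ∈ F → Incident v e → 1 ≤ degree _≟_ F v
  incident⇒degree {(x , y) ∷ F} {v} (here refl) i =
    ≤-trans (≤-trans (s≤s z≤n) (incident-≤ (degree _≟_ F v) i)) (≤-reflexive (sym (degree-∷ x y F v)))
  incident⇒degree {(x , y) ∷ F} {v} (there e∈) i =
    ≤-trans (incident⇒degree e∈ i) (≤-trans (≤-trans (m≤n+m _ ⟦ v ≟ y ⟧) (m≤n+m _ ⟦ v ≟ x ⟧)) (≤-reflexive (sym (degree-∷ x y F v))))

  degree⇒incident : ∀ F {v} → 1 ≤ degree _≟_ F v → ∃[ e ] (e ∈ F × Incident v e)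
  degree⇒incident ((x , y) ∷ F) {v} d rewrite degree-∷ x y F v = by-cases (v ≟ x) (v ≟ y) d
    where
    by-cases : (p : Dec (v ≡ x)) (q : Dec (v ≡ y)) → 1 ≤ ⟦ p ⟧ + (⟦ q ⟧ + degree _≟_ F v) →
      ∃[ e ] (e ∈ (x , y) ∷ F × Incident v e)
    by-cases (yes p) _       _ = (x , y) , here refl , inj₁ p
    by-cases (no _)  (yes q) _ = (x , y) , here refl , inj₂ q
    by-cases (no _)  (no _)  d with degree⇒incident F d
    ... | e , e∈ , i = e , there e∈ , i

  incident-unique : ∀ {F v e e′} → degree _≟_ F v ≡ 1 → e ∈ F → e′ ∈ F → Incident v e → Incident v e′ → e ≡ e′
  incident-unique d (here refl) (here refl) i i′ = refl
  incident-unique {(x , y) ∷ F} {v} d (here refl) (there e′∈) i i′ = ⊥-elim (<-irrefl (sym d)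
    (≤-trans (s≤s (incident⇒degree e′∈ i′)) (≤-trans (incident-≤ (degree _≟_ F v) i) (≤-reflexive (sym (degree-∷ x y F v))))))
  incident-unique {(x , y) ∷ F} {v} d (there e∈) (here refl) i i′ = ⊥-elim (<-irrefl (sym d)
    (≤-trans (s≤s (incident⇒degree e∈ i)) (≤-trans (incident-≤ (degree _≟_ F v) i′) (≤-reflexive (sym (degree-∷ x y F v))))))
  incident-unique {(x , y) ∷ F} {v} d (there e∈) (there e′∈) i i′ =
    incident-unique (≤-antisym
      (≤-trans (≤-trans (m≤n+m _ ⟦ v ≟ y ⟧) (m≤n+m _ ⟦ v ≟ x ⟧)) (≤-reflexive (trans (sym (degree-∷ x y F v)) d)))
      (incident⇒degree e∈ i)) e∈ e′∈ i i′

  loop⇒degree : ∀ {F v} → (v , v) ∈ F → 2 ≤ degree _≟_ F v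
  loop⇒degree {_ ∷ F} {v} (here refl) rewrite degree-∷ v v F v | ⟦⟧-true (v ≟ v) refl = s≤s (s≤s z≤n)
  loop⇒degree {(x , y) ∷ F} {v} (there e∈) =
    ≤-trans (loop⇒degree e∈) (≤-trans (≤-trans (m≤n+m _ ⟦ v ≟ y ⟧) (m≤n+m _ ⟦ v ≟ x ⟧)) (≤-reflexive (sym (degree-∷ x y F v))))

  module Matching {F : Multigraph A} (regular : Regular _≟_ 1 F) where

    adjacent-irrefl : ∀ {v} → ¬ Adjacent F v v
    adjacent-irrefl {v} adj = <-irrefl (sym (regular v)) (loop⇒degree (case adj of λ { (inj₁ e∈) → e∈ ; (inj₂ e∈) → e∈ }))

    partner : ∀ v → ∃[ w ] Adjacent F v w
    partner v with degree⇒incident F (≤-reflexive (sym (regular v)))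
    ... | (x , y) , e∈ , inj₁ refl = y , inj₁ e∈
    ... | (x , y) , e∈ , inj₂ refl = x , inj₂ e∈

    partner-unique : ∀ {v w w′} → Adjacent F v w → Adjacent F v w′ → w ≡ w′
    partner-unique {v} (inj₁ p) (inj₁ q) = ,-injectiveʳ (incident-unique (regular v) p q (inj₁ refl) (inj₁ refl))
    partner-unique {v} (inj₂ p) (inj₂ q) = ,-injectiveˡ (incident-unique (regular v) p q (inj₂ refl) (inj₂ refl))
    partner-unique {v} (inj₁ p) (inj₂ q) with incident-unique (regular v) p q (inj₁ refl) (inj₂ refl)
    ... | refl = refl
    partner-unique {v} (inj₂ p) (inj₁ q) with incident-unique (regular v) p q (inj₂ refl) (inj₁ refl)
    ... | refl = refl

adjacent-sym : {A : Set} {F : Multigraph A} {v w : A} → Adjacent F v w → Adjacent F w v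
adjacent-sym (inj₁ p) = inj₂ p
adjacent-sym (inj₂ p) = inj₁ p

-- From pairings to the exploration

module Completion (n : ℕ) where

  open Configuration n

  _≟ᵉ_ : DecidableEquality (Point n × Point n)
  _≟ᵉ_ = ≡-dec _≟ᵖ_ _≟ᵖ_

  open DecMembership _≟ᵉ_ using (_∈?_)

  adjacent? : ∀ F (e : Point n × Point n) → Dec (Adjacent F (proj₁ e) (proj₂ e))
  adjacent? F e = (e ∈? F) ⊎-dec (swap e ∈? F)

  -- Adjacency instead of membership: the exploration reveals an edge in either orientation, whereas
  -- a pairing stores only one.
  Contained : Multigraph (Point n) → Multigraph (Point n) → Set
  Contained G F = All (λ e → Adjacent F (proj₁ e) (proj₂ e)) G

  contained? : ∀ G F → Dec (Contained G F)
  contained? G F = All.all? (adjacent? F) G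

  contained-adjacent : ∀ {G F h h′} → Contained G F → Adjacent G h h′ → Adjacent F h h′
  contained-adjacent c (inj₁ p) = All.lookup c p
  contained-adjacent c (inj₂ p) = adjacent-sym (All.lookup c p)

  contained-weight : ∀ G F → Contained G F → weight (π F) ≤ weight (π G)
  contained-weight G F c = ^-monoʳ-≤ 16 (α-mono {π F} {π G} λ S ind → AllP.map⁺ (All.map (λ {e} → edge S ind {e}) c))
    where
    edge : ∀ S → Independent (π F) S → ∀ {e} → Adjacent F (proj₁ e) (proj₂ e) → ¬ (proj₁ (proj₁ e) ∈ S × proj₁ (proj₂ e) ∈ S)
    edge S ind (inj₁ e∈) both    = All.lookup (AllP.map⁻ ind) e∈ both
    edge S ind (inj₂ e∈) (p , q) = All.lookup (AllP.map⁻ ind) e∈ (q , p)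

  matching⇒regular : ∀ {F} → F ∈ 𝓕₃ n → Regular _≟ᵖ_ 1 F
  matching⇒regular F∈ = proj₂ (∈-filter⁻ perfectMatching? {xs = sublists (twoSubsets (W n))} F∈)

  Covers : List (Point n) → Multigraph (Point n) → Set
  Covers u G = (∀ h → h ∈ u → ∃[ h′ ] Adjacent G h h′) × (∀ {h h′} → Adjacent G h h′ → h ∈ u)

  covers-∷ : ∀ {u G} h h′ → Covers u G → Covers (h′ ∷ h ∷ u) ((h , h′) ∷ G)
  covers-∷ {u} {G} h h′ (out , back) = out′ , back′
    where
    weaken : ∀ {x y} → Adjacent G x y → Adjacent ((h , h′) ∷ G) x y
    weaken (inj₁ p) = inj₁ (there p)
    weaken (inj₂ p) = inj₂ (there p)
    out′ : ∀ g → g ∈ (h′ ∷ h ∷ u) → ∃[ g′ ] Adjacent ((h , h′) ∷ G) g g′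
    out′ g (here refl)         = h , inj₂ (here refl)
    out′ g (there (here refl)) = h′ , inj₁ (here refl)
    out′ g (there (there g∈)) with out g g∈
    ... | g′ , adj = g′ , weaken adj
    back′ : ∀ {x y} → Adjacent ((h , h′) ∷ G) x y → x ∈ (h′ ∷ h ∷ u)
    back′ (inj₁ (here refl)) = there (here refl)
    back′ (inj₁ (there p))   = there (there (back (inj₁ p)))
    back′ (inj₂ (here refl)) = here refl
    back′ (inj₂ (there p))   = there (there (back (inj₂ p)))

  completions : Multigraph (Point n) → ℕ
  completions G = ∑ (𝓕₃ n) (λ F → ⟦ contained? G F ⟧ * weight (π F))

  ∑∉-∑ : ∀ {B : Set} u (xs : List B) (f : Point n → B → ℕ) →
    ∑∉ u (λ h → ∑ xs (f h)) ≡ ∑ xs (λ x → ∑∉ u (λ h → f h x))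
  ∑∉-∑ u xs f = trans (∑-cong (W n) λ h → sym (∑-*ˡ xs (free u h) (f h))) (∑-swap (W n) xs _)

  ∑∉-single : ∀ {u h} f → h ∉ u → f h ≤ ∑∉ u f
  ∑∉-single f h∉ = ≤-trans (m≤n+m _ _) (≤-reflexive (∑∉-∷ f h∉))

  -- For every pairing that contains `G`, each free point has a partner, and revealing that edge
  -- gives a partial pairing that it still contains.
  completions-match : ∀ u G → Covers u G →
    completions G * #free u ≤ ∑∉ u (λ h → ∑∉ (h ∷ u) λ h′ → completions ((h , h′) ∷ G))
  completions-match u G (out , back) = begin
    completions G * #free u
      ≡⟨ *-comm (completions G) (#free u) ⟩
    #free u * completions G
      ≡⟨ sym (∑-*ˡ (𝓕₃ n) (#free u) _) ⟩
    ∑ (𝓕₃ n) (λ F → #free u * (⟦ contained? G F ⟧ * weight (π F)))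
      ≤⟨ ∑-mono (𝓕₃ n) (λ F F∈ → extend F (matching⇒regular F∈) (contained? G F)) ⟩
    ∑ (𝓕₃ n) (λ F → ∑∉ u λ h → ∑∉ (h ∷ u) λ h′ → ⟦ contained? ((h , h′) ∷ G) F ⟧ * weight (π F))
      ≡⟨ sym (∑∉-∑ u (𝓕₃ n) _) ⟩
    ∑∉ u (λ h → ∑ (𝓕₃ n) λ F → ∑∉ (h ∷ u) λ h′ → ⟦ contained? ((h , h′) ∷ G) F ⟧ * weight (π F))
      ≡⟨ ∑∉-cong u (λ h _ → sym (∑∉-∑ (h ∷ u) (𝓕₃ n) _)) ⟩
    ∑∉ u (λ h → ∑∉ (h ∷ u) λ h′ → completions ((h , h′) ∷ G)) ∎
    where
    open ≤-Reasoning
    extend : ∀ F → Regular _≟ᵖ_ 1 F → (c : Dec (Contained G F)) → #free u * (⟦ c ⟧ * weight (π F)) ≤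
      ∑∉ u (λ h → ∑∉ (h ∷ u) λ h′ → ⟦ contained? ((h , h′) ∷ G) F ⟧ * weight (π F))
    extend F reg (no _)  = ≤-trans (≤-reflexive (*-zeroʳ (#free u))) z≤n
    extend F reg (yes c) = begin
      #free u * (1 * weight (π F))
        ≡⟨ trans (*-comm (#free u) _) (cong (_* #free u) (*-identityˡ (weight (π F)))) ⟩
      weight (π F) * #free u
        ≡⟨ sym (∑∉-const u (weight (π F))) ⟩
      ∑∉ u (λ _ → weight (π F))
        ≤⟨ ∑∉-mono u match-partner ⟩
      ∑∉ u (λ h → ∑∉ (h ∷ u) λ h′ → ⟦ contained? ((h , h′) ∷ G) F ⟧ * weight (π F)) ∎
      where
      open Matching _≟ᵖ_ {F} reg
      match-partner : ∀ h → h ∉ u → weight (π F) ≤ ∑∉ (h ∷ u) λ h′ → ⟦ contained? ((h , h′) ∷ G) F ⟧ * weight (π F)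
      match-partner h h∉ with partner h
      ... | h′ , adj = begin
        weight (π F)
          ≡⟨ sym (trans (cong (_* weight (π F)) (⟦⟧-true (contained? ((h , h′) ∷ G) F) (adj ∷ c))) (*-identityˡ _)) ⟩
        ⟦ contained? ((h , h′) ∷ G) F ⟧ * weight (π F)
          ≤⟨ ∑∉-single (λ h′ → ⟦ contained? ((h , h′) ∷ G) F ⟧ * weight (π F)) fresh ⟩
        ∑∉ (h ∷ u) (λ h′ → ⟦ contained? ((h , h′) ∷ G) F ⟧ * weight (π F)) ∎
        where
        fresh : h′ ∉ (h ∷ u)
        fresh (here refl)  = adjacent-irrefl adj
        -- Were `h′` used, its partner in `G` would be its partner in `F`, which is `h`, and `h`
        -- would be used as well.
        fresh (there h′∈u) with out h′ h′∈u
        ... | g , adj′ with partner-unique (adjacent-sym adj) (contained-adjacent c adj′)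
        ...   | refl = h∉ (back (adjacent-sym adj′))

  -- Once every point is covered, adjacency in `G` determines the pairing, so at most one term
  -- survives.
  completions-covered : ∀ u G → Covers u G → (∀ h → h ∈ u) → completions G ≤ weight (π G)
  completions-covered u G (out , back) all = begin
    completions G
      ≤⟨ ∑-filter-mono perfectMatching? (sublists L) (λ F F∈ reg → determined F (∈sublists⇒⊑ L F∈) reg (contained? G F)) ⟩
    ∑ (sublists L) (λ F → weight (π G) * ⟦ agrees? _≟ᵉ_ (adjacent? G) L F ⟧)
      ≡⟨ ∑-*ˡ (sublists L) (weight (π G)) _ ⟩
    weight (π G) * ∑ (sublists L) (λ F → ⟦ agrees? _≟ᵉ_ (adjacent? G) L F ⟧)
      ≤⟨ *-monoʳ-≤ (weight (π G)) (sublist-determined _≟ᵉ_ (adjacent? G) (twoSubsets-unique (W-unique n))) ⟩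
    weight (π G) * 1
      ≡⟨ *-identityʳ _ ⟩
    weight (π G) ∎
    where
    open ≤-Reasoning
    L : List (Point n × Point n)
    L = twoSubsets (W n)
    determined : ∀ F → F ⊑ L → Regular _≟ᵖ_ 1 F → (c : Dec (Contained G F)) →
      ⟦ c ⟧ * weight (π F) ≤ weight (π G) * ⟦ agrees? _≟ᵉ_ (adjacent? G) L F ⟧
    determined F s reg (no _)  = z≤n
    determined F s reg (yes c) = begin
      1 * weight (π F)   ≡⟨ *-comm 1 (weight (π F)) ⟩
      weight (π F) * 1   ≤⟨ *-mono-≤ (contained-weight G F c) (≤-reflexive (sym (⟦⟧-true (agrees? _≟ᵉ_ (adjacent? G) L F)
                              (All.tabulate λ {e} e∈ → F⊆G e , G⊆F e e∈)))) ⟩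
      weight (π G) * ⟦ agrees? _≟ᵉ_ (adjacent? G) L F ⟧ ∎
      where
      open Matching _≟ᵖ_ {F} reg
      F⊆G : ∀ e → e ∈ F → Adjacent G (proj₁ e) (proj₂ e)
      F⊆G (h , h′) e∈ with out h (all h)
      ... | g , adj with partner-unique (inj₁ e∈) (contained-adjacent c adj)
      ...   | refl = adj
      G⊆F : ∀ e → e ∈ L → Adjacent G (proj₁ e) (proj₂ e) → e ∈ F
      G⊆F e e∈L adj with contained-adjacent c adj
      ... | inj₁ e∈ = e∈
      -- The list of candidate edges holds each pair in one orientation only, and `F` is a sublist
      -- of it.
      ... | inj₂ e∈ = ⊥-elim (twoSubsets-oriented (W-unique n) e∈L (lookup s e∈))

  #free≡0 : ∀ u → #free u ≡ 0 → ∀ h → h ∈ u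
  #free≡0 u eq h with DecMembership._∈?_ _≟ᵖ_ h u
  ... | yes h∈ = h∈
  ... | no h∉ = ⊥-elim (1+n≢0 (trans (#free-∷ h∉) eq))

  -- The t missing edges can be revealed in t! orders and 2 ^ t orientations, and t! 2 ^ t = (2
  -- t)!!.
  completions≤matches : ∀ t u G → Covers u G → #free u ≡ t * 2 →
    completions G * (t * 2) !! ≤ iterate t match Value u G
  completions≤matches zero u G cov eq rewrite eq =
    *-monoˡ-≤ 1 (completions-covered u G cov (#free≡0 u eq))
  completions≤matches (suc t) u G cov eq = begin
    completions G * (suc t * 2 * (t * 2) !!)
      ≡⟨ sym (*-assoc (completions G) (suc t * 2) _) ⟩
    completions G * (suc t * 2) * (t * 2) !!
      ≡⟨ trans (*-comm _ ((t * 2) !!)) (cong (λ m → (t * 2) !! * (completions G * m)) (sym eq)) ⟩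
    (t * 2) !! * (completions G * #free u)
      ≤⟨ *-monoʳ-≤ ((t * 2) !!) (completions-match u G cov) ⟩
    (t * 2) !! * ∑∉ u (λ h → ∑∉ (h ∷ u) λ h′ → completions ((h , h′) ∷ G))
      ≡⟨ sym (trans (∑∉-cong u λ h _ → ∑∉-*ˡ (h ∷ u) ((t * 2) !!) _) (∑∉-*ˡ u ((t * 2) !!) _)) ⟩
    ∑∉ u (λ h → ∑∉ (h ∷ u) λ h′ → (t * 2) !! * completions ((h , h′) ∷ G))
      ≤⟨ ∑∉-mono u (λ h h∉ → ∑∉-mono (h ∷ u) λ h′ h′∉ →
           ≤-trans (≤-reflexive (*-comm ((t * 2) !!) (completions ((h , h′) ∷ G)))) (completions≤matches t (h′ ∷ h ∷ u) ((h , h′) ∷ G) (covers-∷ h h′ cov)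
             (suc-injective (trans (#free-∷ h′∉) (suc-injective (trans (#free-∷ h∉) eq)))))) ⟩
    match (iterate t match Value) u G
      ≡⟨ cong (λ Y → Y u G) (iterate-suc t match Value) ⟩
    iterate (suc t) match Value u G ∎
    where open ≤-Reasoning

  matchings≤matches : ∀ t → 3 * n ≡ t * 2 →
    ∑ (𝓕₃ n) (λ F → weight (π F)) * (t * 2) !! ≤ iterate t match Value [] []
  matchings≤matches t eq = ≤-trans
    (*-monoˡ-≤ ((t * 2) !!) (≤-reflexive (∑-cong (𝓕₃ n) λ F → sym (*-identityˡ (weight (π F))))))
    (completions≤matches t [] [] ((λ h ()) , λ { (inj₁ ()) ; (inj₂ ()) }) (trans #free-[] eq))

-- Bounding the total weight of all pairings

factorial-!! : ∀ m → (suc m) ! ≡ (suc m) !! * m !!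
factorial-!! zero    = refl
factorial-!! (suc m) = trans (cong (suc (suc m) *_) (trans (factorial-!! m) (*-comm ((suc m) !!) (m !!))))
                             (sym (*-assoc (suc (suc m)) (m !!) ((suc m) !!)))

!!≥1 : ∀ m → 1 ≤ m !!
!!≥1 zero          = ≤-refl
!!≥1 (suc zero)    = ≤-refl
!!≥1 (suc (suc m)) = *-mono-≤ {1} {suc (suc m)} (s≤s z≤n) (!!≥1 m)

module _ (S : ℕ → ℕ → ℕ) (a b c K : ℕ)
  (step : ∀ k f → k * 2 + f ≤ K * 2 → a * S (suc k) f + b * S k f ≤ c * S k (suc f)) where

  -- The factor 4 comes from summing over all paths from (0 , 2 K) to (K , 0); a single path would
  -- give only `a * b`.
  matches≤kills : (4 * a * b) ^ K * S K 0 ≤ suc K * suc K * (c * c) ^ K * S 0 (K * 2)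
  matches≤kills = *-cancelˡ-≤ ((K * 2) !) {{(K * 2) !≢0}} (begin
    (K * 2) ! * ((4 * a * b) ^ K * S K 0)
      ≡⟨ cong (λ x → (K * 2) ! * (x * S K 0)) (trans (^-distribˡ-* (4 * a) b K) (cong (_* b ^ K) (^-distribˡ-* 4 a K))) ⟩
    (K * 2) ! * (4 ^ K * a ^ K * b ^ K * S K 0)
      ≡⟨ l₁ ((K * 2) !) (4 ^ K) (a ^ K) (b ^ K) (S K 0) ⟩
    4 ^ K * ((K * 2) ! * 1 * a ^ K * b ^ K * S K 0)
      ≤⟨ *-monoʳ-≤ (4 ^ K) (Ballot.ballot S a b c K step K 0 0 (K * 2) K (sym (+-identityʳ _)) (sym (+-identityʳ _)) refl) ⟩
    4 ^ K * (c ^ (K * 2) * K ! * (suc K) ! * S 0 (K * 2))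
      ≡⟨ l₂ (4 ^ K) (c ^ (K * 2)) (K !) ((suc K) !) (S 0 (K * 2)) ⟩
    (4 ^ K * K ! * (suc K) !) * (c ^ (K * 2) * S 0 (K * 2))
      ≤⟨ *-monoˡ-≤ (c ^ (K * 2) * S 0 (K * 2)) (catalan-bound K) ⟩
    (suc K * suc K * (K * 2) !) * (c ^ (K * 2) * S 0 (K * 2))
      ≡⟨ cong (λ x → (suc K * suc K * (K * 2) !) * (x * S 0 (K * 2)))
           (trans (cong (c ^_) (*-comm K 2)) (trans (sym (^-*-assoc c 2 K)) (cong (λ y → (c * y) ^ K) (*-identityʳ c)))) ⟩
    (suc K * suc K * (K * 2) !) * ((c * c) ^ K * S 0 (K * 2))
      ≡⟨ l₃ (suc K * suc K) ((K * 2) !) ((c * c) ^ K) (S 0 (K * 2)) ⟩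
    (K * 2) ! * (suc K * suc K * (c * c) ^ K * S 0 (K * 2)) ∎)
    where
    open ≤-Reasoning
    l₁ : ∀ F p q r s → F * (p * q * r * s) ≡ p * (F * 1 * q * r * s)
    l₁ = solve-∀
    l₂ : ∀ p c k k′ s → p * (c * k * k′ * s) ≡ (p * k * k′) * (c * s)
    l₂ = solve-∀
    l₃ : ∀ k F c s → (k * F) * (c * s) ≡ F * (k * c * s)
    l₃ = solve-∀

-- The exploration carries the factor (3 n)! = (3 n)!! (3 n - 1)!!. Its first part is the
-- multiplicity with which `matchings≤matches` counts every pairing, and it cancels.
partition-bound : ∀ n K s m → 3 * n ≡ (s + K) * 2 → 3 * n ≡ suc m → K * 2 + 300 ≤ 3 * n →
  (4 * 1200 * 699) ^ K * ∑ (𝓕₃ n) (λ F → 16 ^ α (π F)) ≤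
  suc K * suc K * (800 * 800) ^ K * (42 ^ n * m !!)
partition-bound n K s m 3n≡ 3n≡suc 300≤ =
  *-cancelˡ-≤ ((3 * n) !!) {{>-nonZero (!!≥1 (3 * n))}} (begin
  (3 * n) !! * (A ^ K * Z)
    ≡⟨ l₁ ((3 * n) !!) (A ^ K) Z ⟩
  A ^ K * (Z * (3 * n) !!)
    ≤⟨ *-monoʳ-≤ (A ^ K) (≤-trans (subst (λ x → Z * x !! ≤ iterate (s + K) match Value [] []) (sym 3n≡) (matchings≤matches (s + K) 3n≡))
                                   (matches-Value s K [] [])) ⟩
  A ^ K * S K 0
    ≤⟨ matches≤kills S 1200 699 800 K step ⟩
  B * S 0 (K * 2)
    ≤⟨ *-monoʳ-≤ B (kills-Value (K * 2)) ⟩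
  B * ((3 * n) ! * 42 ^ n)
    ≡⟨ cong (λ x → B * (x * 42 ^ n)) (trans (cong _! 3n≡suc) (trans (factorial-!! m) (cong (λ x → x !! * m !!) (sym 3n≡suc)))) ⟩
  B * ((3 * n) !! * m !! * 42 ^ n)
    ≡⟨ l₂ B ((3 * n) !!) (m !!) (42 ^ n) ⟩
  (3 * n) !! * (B * (42 ^ n * m !!)) ∎)
  where
  open ≤-Reasoning
  open Configuration n
  open Completion n
  S : ℕ → ℕ → ℕ
  S k f = explore k f Value [] []
  A B Z : ℕ
  A = 4 * 1200 * 699
  B = suc K * suc K * (800 * 800) ^ K
  Z = ∑ (𝓕₃ n) (λ F → 16 ^ α (π F))
  step : ∀ k f → k * 2 + f ≤ K * 2 → 1200 * S (suc k) f + 699 * S k f ≤ 800 * S k (suc f)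
  step k f le = subst (λ x → 1200 * x + 699 * S k f ≤ 800 * S k (suc f)) (explore-match k f {Value} Value-symmetric [] [])
    (explore-bound k f {300} {1200} {699} {800} {match Value} {Value} {kill Value} Value-bound [] [] (begin
      k * 2 + (f + 300)  ≡⟨ sym (+-assoc (k * 2) f 300) ⟩
      k * 2 + f + 300    ≤⟨ +-monoˡ-≤ 300 le ⟩
      K * 2 + 300        ≤⟨ 300≤ ⟩
      3 * n              ≡⟨ sym #free-[] ⟩
      #free []           ∎))
  l₁ : ∀ d a z → d * (a * z) ≡ a * (z * d)
  l₁ = solve-∀
  l₂ : ∀ b d m p → b * (d * m * p) ≡ d * (b * (p * m))
  l₂ = solve-∀

-- Two of the three factors `suc l` pay for the square of `suc (l * 24)`, at the price 24² = 576.
-- The third becomes the factor `l` of the conclusion, which makes `bad` of order M / l for bounded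
-- r.
exponential-wins : ∀ p A C E T l r M Z bad .{{_ : NonZero p}} .{{_ : NonZero A}} →
  bad * p ^ l ≤ Z →
  A ^ (l * 24) * Z ≤ suc (l * 24) * suc (l * 24) * C ^ (l * 24) * (E ^ (l * 16 + r) * M) →
  suc l * suc l * suc l * (C ^ 24 * E ^ 16) ^ l ≤ T * (p * A ^ 24) ^ l →
  l * bad ≤ 576 * T * E ^ r * M
exponential-wins p A C E T l r M Z bad bad≤ Z≤ cubic =
  *-cancelˡ-≤ ((p * A ^ 24) ^ l) {{m^n≢0 (p * A ^ 24) l {{m*n≢0 p (A ^ 24) {{it}} {{m^n≢0 A 24}}}}}} (begin
  (p * A ^ 24) ^ l * (l * bad)
    ≡⟨ cong (_* (l * bad)) (trans (^-distribˡ-* p (A ^ 24) l) (cong (p ^ l *_) (^-^ A 24))) ⟩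
  p ^ l * A ^ (l * 24) * (l * bad)
    ≡⟨ l₁ (p ^ l) (A ^ (l * 24)) l bad ⟩
  l * (A ^ (l * 24) * (bad * p ^ l))
    ≤⟨ *-monoʳ-≤ l (≤-trans (*-monoʳ-≤ (A ^ (l * 24)) bad≤) Z≤) ⟩
  l * (suc (l * 24) * suc (l * 24) * C ^ (l * 24) * (E ^ (l * 16 + r) * M))
    ≡⟨ cong (λ x → l * (suc (l * 24) * suc (l * 24) * C ^ (l * 24) * (x * M))) (^-distribˡ-+-* E (l * 16) r) ⟩
  l * (suc (l * 24) * suc (l * 24) * C ^ (l * 24) * (E ^ (l * 16) * E ^ r * M))
    ≤⟨ *-mono-≤ (n≤1+n l) (*-monoˡ-≤ (E ^ (l * 16) * E ^ r * M) (*-monoˡ-≤ (C ^ (l * 24)) (*-mono-≤ linear linear))) ⟩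
  suc l * (suc l * 24 * (suc l * 24) * C ^ (l * 24) * (E ^ (l * 16) * E ^ r * M))
    ≡⟨ l₂ (suc l) (C ^ (l * 24)) (E ^ (l * 16)) (E ^ r) M ⟩
  suc l * suc l * suc l * (C ^ (l * 24) * E ^ (l * 16)) * (576 * E ^ r * M)
    ≡⟨ cong (λ x → suc l * suc l * suc l * x * (576 * E ^ r * M))
         (sym (trans (^-distribˡ-* (C ^ 24) (E ^ 16) l) (cong₂ _*_ (^-^ C 24) (^-^ E 16)))) ⟩
  suc l * suc l * suc l * (C ^ 24 * E ^ 16) ^ l * (576 * E ^ r * M)
    ≤⟨ *-monoˡ-≤ (576 * E ^ r * M) cubic ⟩
  T * (p * A ^ 24) ^ l * (576 * E ^ r * M)
    ≡⟨ l₃ T ((p * A ^ 24) ^ l) (E ^ r) M ⟩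
  (p * A ^ 24) ^ l * (576 * T * E ^ r * M) ∎)
  where
  open ≤-Reasoning
  ^-^ : ∀ x k → (x ^ k) ^ l ≡ x ^ (l * k)
  ^-^ x k = trans (^-*-assoc x k l) (cong (x ^_) (*-comm k l))
  linear : suc (l * 24) ≤ suc l * 24
  linear = +-monoˡ-≤ (l * 24) {1} {24} (s≤s z≤n)
  l₁ : ∀ p a l b → p * a * (l * b) ≡ l * (a * (b * p))
  l₁ = solve-∀
  l₂ : ∀ s c e R M → s * (s * 24 * (s * 24) * c * (e * R * M)) ≡ s * s * s * (c * e) * (576 * R * M)
  l₂ = solve-∀
  l₃ : ∀ T x R M → T * x * (576 * R * M) ≡ x * (576 * T * R * M)
  l₃ = solve-∀

-- Markov's inequality and the limit

open import Data.Integer as ℤ using (+_; +[1+_])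
import Data.Integer.Properties as ℤ
open import Data.Rational as ℚ using (ℚ; 0ℚ; mkℚ; _/_; _<?_)
import Data.Rational.Properties as ℚ
open import Data.Rational.Unnormalised as ℚᵘ using (mkℚᵘ; *<*)
import Data.Rational.Unnormalised.Properties as ℚᵘ

dense : (n : ℕ) → List (Multigraph (Point n))
dense n = filter (λ F → (+ 454 ℚ./ 1000) ℚ.* (+ n ℚ./ 1) <? (+ α (π F) ℚ./ 1)) (𝓖′ 16 n)

toℕ-< : ∀ n a → (+ 454 ℚ./ 1000) ℚ.* (+ n ℚ./ 1) ℚ.< (+ a ℚ./ 1) → 454 * n < a * 1000
toℕ-< n a lt = ℤ.drop‿+<+ (subst₂ ℤ._<_ left right (ℚᵘ.drop-*<* (ℚᵘ.<-respʳ-≃ (ℚ.toℚᵘ-fromℚᵘ (mkℚᵘ (+ a) 0))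
  (ℚᵘ.<-respˡ-≃ (ℚᵘ.≃-trans (ℚ.toℚᵘ-homo-* (+ 454 ℚ./ 1000) (+ n ℚ./ 1))
      (ℚᵘ.*-cong (ℚ.toℚᵘ-fromℚᵘ (mkℚᵘ (+ 454) 999)) (ℚ.toℚᵘ-fromℚᵘ (mkℚᵘ (+ n) 0))))
    (ℚ.toℚᵘ-mono-< lt)))))
  where
  left : (+ 454 ℤ.* + n) ℤ.* + 1 ≡ + (454 * n)
  left = trans (ℤ.*-identityʳ _) (sym (ℤ.pos-* 454 n))
  right : + a ℤ.* + 1000 ≡ + (a * 1000)
  right = sym (ℤ.pos-* a 1000)

-- A positive rational has numerator at least 1, so it is at least the reciprocal of its
-- denominator.
fromℕ-< : ∀ ε → ε ℚ.> 0ℚ → ∀ bad M → bad * suc (ℚ.denominator-1 ε) < M → (+ bad ℚ./ 1) ℚ.< ε ℚ.* (+ M ℚ./ 1)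
fromℕ-< ε@(mkℚ (+ zero) d _)   (ℚ.*<* (ℤ.+<+ ())) bad M lt
fromℕ-< ε@(mkℚ (ℤ.-[1+ k ]) d _) (ℚ.*<* ()) bad M lt
fromℕ-< ε@(mkℚ +[1+ p ] d _) _ bad M lt = ℚ.toℚᵘ-cancel-< (ℚᵘ.<-respˡ-≃ (ℚᵘ.≃-sym (ℚ.toℚᵘ-fromℚᵘ (mkℚᵘ (+ bad) 0)))
  (ℚᵘ.<-respʳ-≃ (ℚᵘ.≃-sym (ℚᵘ.≃-trans (ℚ.toℚᵘ-homo-* ε (+ M ℚ./ 1)) (ℚᵘ.*-congˡ {mkℚᵘ +[1+ p ] d} (ℚ.toℚᵘ-fromℚᵘ (mkℚᵘ (+ M) 0)))))
    (*<* (subst₂ ℤ._<_ (sym left) (sym right) (ℤ.+<+ bound)))))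
  where
  bound : bad * (suc d * 1) < suc p * M
  bound = ≤-trans (≤-reflexive (cong (λ x → suc (bad * x)) (*-identityʳ (suc d)))) (≤-trans lt (m≤m+n M _))
  left : + bad ℤ.* (+ (suc d * 1)) ≡ + (bad * (suc d * 1))
  left = sym (ℤ.pos-* bad (suc d * 1))
  right : (+[1+ p ] ℤ.* + M) ℤ.* + 1 ≡ + (suc p * M)
  right = trans (ℤ.*-identityʳ _) (sym (ℤ.pos-* (suc p) M))

-- 29 = ⌊0.454 · 16 · log₂ 16⌋, so 2 ^ 29 is the weight gained per 16 vertices.
dense-markov : ∀ l r → length (dense (l * 16 + r)) * (2 ^ 29) ^ l ≤ ∑ (𝓕₃ (l * 16 + r)) (λ F → 16 ^ α (π F))
dense-markov l r = ≤-trans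
  (markov _ (𝓖′ 16 (l * 16 + r)) (λ F → 16 ^ α (π F)) ((2 ^ 29) ^ l) λ F lt → weight≥ (α (π F)) (toℕ-< (l * 16 + r) (α (π F)) lt))
  (∑-filter-≤ _ (𝓕₃ (l * 16 + r)) _)
  where
  open ≤-Reasoning
  l₁ : ∀ l r → 250 * (29 * l) + (14 * l + 454 * r) ≡ 454 * (l * 16 + r)
  l₁ = solve-∀
  l₂ : ∀ a → a * 1000 ≡ 250 * (4 * a)
  l₂ = solve-∀
  weight≥ : ∀ a → 454 * (l * 16 + r) < a * 1000 → (2 ^ 29) ^ l ≤ 16 ^ a
  weight≥ a lt = begin
    (2 ^ 29) ^ l  ≡⟨ ^-*-assoc 2 29 l ⟩
    2 ^ (29 * l)  ≤⟨ ^-monoʳ-≤ 2 (*-cancelˡ-≤ {29 * l} {4 * a} 250 (begin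
      250 * (29 * l)                        ≤⟨ m≤m+n _ _ ⟩
      250 * (29 * l) + (14 * l + 454 * r)   ≡⟨ l₁ l r ⟩
      454 * (l * 16 + r)                    ≤⟨ <⇒≤ lt ⟩
      a * 1000                              ≡⟨ l₂ a ⟩
      250 * (4 * a)                         ∎)) ⟩
    2 ^ (4 * a)   ≡⟨ sym (^-*-assoc 2 4 a) ⟩
    16 ^ a        ∎

-- The gain and the loss over 16 vertices, that is 24 matches; the spare factor
-- (51/50)³ per block is what beats the polynomial factors.
block-ratio : (800 * 800) ^ 24 * 42 ^ 16 * (51 * 51 * 51) ≤ 2 ^ 29 * (4 * 1200 * 699) ^ 24 * (50 * 50 * 50)
block-ratio = ≤ᵇ⇒≤ ((800 * 800) ^ 24 * 42 ^ 16 * (51 * 51 * 51)) (2 ^ 29 * (4 * 1200 * 699) ^ 24 * (50 * 50 * 50)) _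

cubic≤block : ∀ l → suc l * suc l * suc l * ((800 * 800) ^ 24 * 42 ^ 16) ^ l ≤ 50 * 50 * 50 * (2 ^ 29 * (4 * 1200 * 699) ^ 24) ^ l
cubic≤block = cubic≤exponential 50 51 (2 ^ 29 * (4 * 1200 * 699) ^ 24) ((800 * 800) ^ 24 * 42 ^ 16) bernoulli block-ratio

dense-bound : ∀ l r s m → 3 * (l * 16 + r) ≡ (s + l * 24) * 2 → 3 * (l * 16 + r) ≡ suc m → l * 24 * 2 + 300 ≤ 3 * (l * 16 + r) →
  l * length (dense (l * 16 + r)) ≤ 576 * (50 * 50 * 50) * 42 ^ r * m !!
dense-bound l r s m 3n≡ 3n≡suc 300≤ = exponential-wins (2 ^ 29) (4 * 1200 * 699) (800 * 800) 42 (50 * 50 * 50)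
  l r (m !!) (∑ (𝓕₃ (l * 16 + r)) (λ F → 16 ^ α (π F))) (length (dense (l * 16 + r)))
  (dense-markov l r) (partition-bound (l * 16 + r) (l * 24) s m 3n≡ 3n≡suc 300≤) (cubic≤block l)

-- The reserve of 2 k vertices is set aside before division into blocks, so what lies outside the
-- blocks is bounded from both sides.
decompose : ∀ k n → 2 ∣ n → k * 2 ≤ n → ∃[ l ] ∃[ t ] (t ≤ 7 × n ≡ l * 16 + (k + t) * 2)
decompose k n (divides q n≡) 2k≤n with m≤n⇒∃[o]m+o≡n (*-cancelʳ-≤ k q 2 (≤-trans 2k≤n (≤-reflexive n≡)))
... | o , q≡ = o ℕ./ 8 , o ℕ.% 8 , ≤-pred (ℕ.m%n<n o 8) ,
  trans n≡ (trans (cong (_* 2) (trans (sym q≡) (cong (λ x → k + x) (ℕ.m≡m%n+[m/n]*n o 8)))) (lemma k (o ℕ.% 8) (o ℕ./ 8)))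
  where
  lemma : ∀ k t l → (k + (t + l * 8)) * 2 ≡ l * 16 + (k + t) * 2
  lemma = solve-∀

vanishing : ∀ C D l bad M → 1 ≤ M → l * bad ≤ C * M → C * D < l → bad * D < M
vanishing C D l bad M 1≤M l*bad≤ CD<l = *-cancelˡ-< l (bad * D) M (begin-strict
  l * (bad * D)   ≡⟨ sym (*-assoc l bad D) ⟩
  l * bad * D     ≤⟨ *-monoˡ-≤ D l*bad≤ ⟩
  C * M * D       ≡⟨ lemma C M D ⟩
  C * D * M       <⟨ *-monoˡ-< M {{>-nonZero 1≤M}} CD<l ⟩
  l * M           ∎)
  where
  open ≤-Reasoning
  lemma : ∀ C M D → C * M * D ≡ C * D * M
  lemma = solve-∀

few-dense : ∀ C D l r s → (42 ^ r) * (576 * (50 * 50 * 50)) ≤ C → C * D < l →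
  3 * (l * 16 + r) ≡ (s + l * 24) * 2 → l * 24 * 2 + 300 ≤ 3 * (l * 16 + r) →
  length (dense (l * 16 + r)) * D < (3 * (l * 16 + r) ∸ 1) !!
few-dense C D l r s ≤C CD<l 3n≡ 300≤ = vanishing C D l _ M (!!≥1 (3 * (l * 16 + r) ∸ 1))
  (≤-trans (dense-bound l r s (3 * (l * 16 + r) ∸ 1) 3n≡ (sym (m+[n∸m]≡n (≤-trans (≤-trans (s≤s z≤n) (m≤n+m 300 (l * 24 * 2))) 300≤))) 300≤)
    (*-monoˡ-≤ M (≤-trans (≤-reflexive (*-comm (576 * (50 * 50 * 50)) (42 ^ r))) ≤C)))
  CD<l
  where
  M : ℕ
  M = (3 * (l * 16 + r) ∸ 1) !!

threshold : ∀ C → (∀ r → r ≤ 114 → 42 ^ r * (576 * (50 * 50 * 50)) ≤ C) → ∀ D n → 2 ∣ n → n > C * D * 16 + 114 →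
  length (dense n) * D < (3 * n ∸ 1) !!
threshold C ≤C D n 2∣n n>N = conclude
  -- 50 pairs of vertices carry the 300 reserved points; with at most 7 further pairs the reserve
  -- has at most 114 vertices.
  (decompose 50 n 2∣n (≤-trans (m≤n+m 100 14) (≤-trans (m≤n+m 114 (C * D * 16)) (<⇒≤ n>N)))) n>N
  where
  l₁ : ∀ l k → 3 * (l * 16 + k * 2) ≡ (k * 3 + l * 24) * 2
  l₁ = solve-∀
  l₂ : ∀ l k → l * 24 * 2 + k * 6 ≡ 3 * (l * 16 + k * 2)
  l₂ = solve-∀
  conclude : ∀ {n} → ∃[ l ] ∃[ t ] (t ≤ 7 × n ≡ l * 16 + (50 + t) * 2) → n > C * D * 16 + 114 →
    length (dense n) * D < (3 * n ∸ 1) !!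
  conclude (l , t , t≤7 , refl) n>N = few-dense C D l ((50 + t) * 2) ((50 + t) * 3) (≤C ((50 + t) * 2) r≤)
    (*-cancelʳ-< 16 (C * D) l (+-cancelʳ-< 114 (C * D * 16) (l * 16) (≤-trans n>N (+-monoʳ-≤ (l * 16) r≤))))
    (l₁ l (50 + t))
    (≤-trans (+-monoʳ-≤ (l * 24 * 2) (*-monoˡ-≤ 6 (m≤m+n 50 t))) (≤-reflexive (l₂ l (50 + t))))
    where
    r≤ : (50 + t) * 2 ≤ 114
    r≤ = *-monoˡ-≤ 2 (+-monoʳ-≤ 50 t≤7)

power-bounded : ∀ b .{{_ : NonZero b}} K s → ∃[ C ] (∀ r → r ≤ s → b ^ r * K ≤ C)
power-bounded b K s = b ^ s * K , λ r r≤s → *-monoˡ-≤ K (^-monoʳ-≤ b r≤s)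

few-dense-ℚ : ∀ ε → ε ℚ.> 0ℚ → ∃[ C ] (∀ r → r ≤ 114 → 42 ^ r * (576 * (50 * 50 * 50)) ≤ C) →
  ∃[ N ] (N > 0 × (∀ n → 2 ∣ n → n > N → (+ length (dense n)) / 1 ℚ.< ε ℚ.* ((+ ((3 * n ∸ 1) !!)) / 1)))
few-dense-ℚ ε ε>0 (C , ≤C) = C * D * 16 + 114 , ≤-trans (s≤s z≤n) (m≤n+m 114 (C * D * 16)) ,
  λ n 2∣n n>N → fromℕ-< ε ε>0 (length (dense n)) ((3 * n ∸ 1) !!) (threshold C ≤C D n 2∣n n>N)
  where
  D : ℕ
  D = suc (ℚ.denominator-1 ε)

theorem5 : (ε : ℚ) → ε ℚ.> 0ℚ →
    ∃[ N ] (N > 0 × ((n : ℕ) → 2 ∣ n → n > N →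
    (+ length (filter (λ F → (+ 454 / 1000) ℚ.* (+ n / 1) <? (+ α (π F) / 1)) (𝓖′ 16 n))) / 1
    ℚ.< ε ℚ.* ((+ ((3 * n ∸ 1) !!)) / 1)))
theorem5 ε ε>0 = few-dense-ℚ ε ε>0 (power-bounded 42 (576 * (50 * 50 * 50)) 114)
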